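{- Let $A\subseteq\mathbb{N}$ and let $S_A:=\{(n,\top)\mid n\in A\}\cup\{(n,\bot)\mid n\notin A\}$, regarded as a subspace of $\mathbb{N}\times\mathbb{S}$. Then $S_A$ is precomputably Quasi-Polish if and only if $A$ is $\Delta^0_2$.
   Context: A represented space $\mathbf{X}=(X,\delta_{\mathbf{X}})$ is a set $X$ with a partial surjection $\delta_{\mathbf{X}}:\subseteq\mathbb{N}^{\mathbb{N}}\to X$; any $p$ with $\delta_{\mathbf X}(p)=x$ is a name of $x$. A subspace is a subset with the restricted representation (a point keeps all its names). A map $f:\mathbf{X}\to\mathbf{Y}$ is computable if some computable partial map on $\mathbb{N}^{\mathbb{N}}$ sends every name of every $x\in X$ to a name of $f(x)$. A computable isomorphism is a computable bijection with computable inverse. $\mathbb{N}$ is represented by $\delta_{\mathbb N}(p)=p(0)$. In the product $\mathbf{X}\times\mathbf{Y}$, $p$ names $(x,y)$ iff $n\mapsto p(2n)$ names $x$ and $n\mapsto p(2n+1)$ names $y$. Sierpinski space $\mathbb{S}=\{\top,\bot\}$ is represented so that $0^\omega$ names $\bot$ and every other sequence names $\top$. For a transitive relation $\ll$ on $\mathbb{N}$, an ideal is a non-empty $I\subseteq\mathbb{N}$ such that $x\ll y\in I$ implies $x\in I$, and for all $x,y\in I$ there is $z\in I$ with $x\ll z$ and $y\ll z$. $\mathbf{I}(\ll)$ is the represented space of ideals, where $p$ names $I$ iff $I=\{p(k)\mid k\in\mathbb{N}\}$. A represented space is precomputably Quasi-Polish if it is computably isomorphic to $\mathbf{I}(\ll)$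 for some computably enumerable transitive relation $\ll$ on $\mathbb N$. $\Delta^0_2$ refers to the (lightface) arithmetical hierarchy. -}

module Defs where

open import Axiom.ExcludedMiddle using (ExcludedMiddle)
open import Data.Empty using (⊥-elim)
open import Data.Fin using (Fin)
open import Data.Nat using (ℕ; zero; suc; _+_; _*_; _<_)
open import Data.Nat.Properties using (+-suc; 1+n≢0)
open import Data.Product using (∃; _×_; _,_; proj₁; proj₂)
open import Data.Product.Relation.Binary.Pointwise.NonDependent using (×-setoid)
open import Data.Sum using (_⊎_)
open import Data.Vec using (Vec; []; _∷_; [_]; lookup)
open import Data.Vec.Relation.Binary.Pointwise.Inductive using (Pointwise)
open import Function using (_∘_; _⇔_; Inverse)
open import Level using (Level; 0ℓ) renaming (suc to lsuc)
open import Relation.Binary using (Rel; Setoid; Transitive)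
import Relation.Binary.Construct.On as On
open import Relation.Binary.PropositionalEquality
  using (_≡_; _≗_; refl; sym; trans; setoid)
open import Relation.Nullary using (¬_; yes; no)
open import Relation.Unary using (Pred; _∈_; _∉_; _≐_)
open import Relation.Unary.Relation.Binary.Equality using (≐-setoid)

private
  variable
    a b : Level
    j k m n : ℕ

Baire : Set
Baire = ℕ → ℕ

-- Partial recursive functions of arity k relative to j total oracles.

data Code (j : ℕ) : ℕ → Set where
  zer    : Code j k
  succ   : Code j 1
  proj   : Fin k → Code j k
  oracle : Fin j → Code j 1
  comp   : Code j m → Vec (Code j k) m → Code j k
  prec   : Code j k → Code j (2 + k) → Code j (1 + k)
  μ      : Code j (1 + k) → Code j k

infix 4 _⊢_⟨_⟩⇓_

-- φ ⊢ e ⟨ xs ⟩⇓ y : with oracles φ, the program e halts on xs with output y.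

data _⊢_⟨_⟩⇓_ (φ : Vec Baire j) : Code j k → Vec ℕ k → ℕ → Set where
  zer    : {xs : Vec ℕ k} → φ ⊢ zer ⟨ xs ⟩⇓ 0
  succ   : ∀ {x} → φ ⊢ succ ⟨ [ x ] ⟩⇓ suc x
  proj   : {xs : Vec ℕ k} (i : Fin k) → φ ⊢ proj i ⟨ xs ⟩⇓ lookup xs i
  oracle : ∀ {x} (i : Fin j) → φ ⊢ oracle i ⟨ [ x ] ⟩⇓ lookup φ i x
  comp   : {f : Code j m} {gs : Vec (Code j k) m} {xs : Vec ℕ k} {ys : Vec ℕ m} {z : ℕ} →
           Pointwise (λ g y → φ ⊢ g ⟨ xs ⟩⇓ y) gs ys →
           φ ⊢ f ⟨ ys ⟩⇓ z →
           φ ⊢ comp f gs ⟨ xs ⟩⇓ z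
  prec-z : {f : Code j k} {g : Code j (2 + k)} {xs : Vec ℕ k} {y : ℕ} →
           φ ⊢ f ⟨ xs ⟩⇓ y →
           φ ⊢ prec f g ⟨ 0 ∷ xs ⟩⇓ y
  prec-s : {f : Code j k} {g : Code j (2 + k)} {xs : Vec ℕ k} {i y z : ℕ} →
           φ ⊢ prec f g ⟨ i ∷ xs ⟩⇓ y →
           φ ⊢ g ⟨ i ∷ y ∷ xs ⟩⇓ z →
           φ ⊢ prec f g ⟨ suc i ∷ xs ⟩⇓ z
  μ      : {f : Code j (1 + k)} {xs : Vec ℕ k} {y : ℕ} →
           φ ⊢ f ⟨ y ∷ xs ⟩⇓ 0 →
           (∀ i → i < y → ∃ λ v → φ ⊢ f ⟨ i ∷ xs ⟩⇓ suc v) →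
           φ ⊢ μ f ⟨ xs ⟩⇓ y

-- The computable partial map on Baire space given by e is defined at p iff e
-- with oracle p is total; its value is then the function so computed.

_⟪_⟫≃_ : Code 1 1 → Baire → Baire → Set
e ⟪ p ⟫≃ q = ∀ n → [ p ] ⊢ e ⟨ [ n ] ⟩⇓ q n

ComputablyEnumerable : Rel ℕ 0ℓ → Set
ComputablyEnumerable _∼_ =
  ∃ λ (e : Code 0 2) → ∀ x y → (x ∼ y) ⇔ (∃ λ v → [] ⊢ e ⟨ x ∷ y ∷ [] ⟩⇓ v)

Recursive : Pred (Vec ℕ k) 0ℓ → Set
Recursive {k} R = ∃ λ (e : Code 0 k) → ∀ xs →
  (xs ∈ R × [] ⊢ e ⟨ xs ⟩⇓ 1) ⊎ (xs ∉ R × [] ⊢ e ⟨ xs ⟩⇓ 0)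

mutual
  data Σ⁰ : ℕ → Pred (Vec ℕ k) 0ℓ → Set₁ where
    recursive : {R : Pred (Vec ℕ k) 0ℓ} → Recursive R → Σ⁰ 0 R
    exists    : {R : Pred (Vec ℕ k) 0ℓ} {B : Pred (Vec ℕ (1 + k)) 0ℓ} →
                Π⁰ n B → R ≐ (λ xs → ∃ λ y → B (y ∷ xs)) → Σ⁰ (suc n) R

  data Π⁰ : ℕ → Pred (Vec ℕ k) 0ℓ → Set₁ where
    recursive : {R : Pred (Vec ℕ k) 0ℓ} → Recursive R → Π⁰ 0 R
    forAll    : {R : Pred (Vec ℕ k) 0ℓ} {B : Pred (Vec ℕ (1 + k)) 0ℓ} →
                Σ⁰ n B → R ≐ (λ xs → ∀ y → B (y ∷ xs)) → Π⁰ (suc n) R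

Δ⁰ : ℕ → Pred (Vec ℕ k) 0ℓ → Set₁
Δ⁰ n R = Σ⁰ n R × Π⁰ n R

-- The partial surjection δ is given by its graph `names`; the underlying set is
-- a setoid because ideals are compared extensionally.

record RepresentedSpace (a : Level) : Set (lsuc a) where
  field
    points : Setoid a 0ℓ
  open Setoid points public using (Carrier; _≈_)
  field
    names      : Baire → Carrier → Set
    respects   : ∀ {p q x y} → p ≗ q → x ≈ y → names p x → names q y
    functional : ∀ {p x y} → names p x → names p y → x ≈ y
    surjective : ∀ x → ∃ λ p → names p x

open RepresentedSpace

Computable : (X : RepresentedSpace a) (Y : RepresentedSpace b) →
             (Carrier X → Carrier Y) → Set a
Computable X Y f = ∃ λ (e : Code 1 1) →
  ∀ p x → names X p x → ∃ λ q → e ⟪ p ⟫≃ q × names Y q (f x)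

record _≅_ (X : RepresentedSpace a) (Y : RepresentedSpace b) : Set (a Level.⊔ b) where
  field
    inverse         : Inverse (points X) (points Y)
  open Inverse inverse using (to; from)
  field
    to-computable   : Computable X Y to
    from-computable : Computable Y X from

subspace : (X : RepresentedSpace a) → Pred (Carrier X) 0ℓ → RepresentedSpace a
subspace X P = record
  { points     = On.setoid {B = ∃ P} (points X) proj₁
  ; names      = λ p x → names X p (proj₁ x)
  ; respects   = respects X
  ; functional = functional X
  ; surjective = surjective X ∘ proj₁
  }

ℕ-space : RepresentedSpace 0ℓ
ℕ-space = record
  { points     = setoid ℕ
  ; names      = λ p n → p 0 ≡ n
  ; respects   = λ { p≗q refl p0≡n → trans (sym (p≗q 0)) p0≡n }
  ; functional = λ p0≡m p0≡n → trans (sym p0≡m) p0≡n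
  ; surjective = λ n → (λ _ → n) , refl
  }

data Sierpiński : Set where
  ⊤ ⊥ : Sierpiński

IsZero : Baire → Set
IsZero p = ∀ n → p n ≡ 0

namesSierpiński : Baire → Sierpiński → Set
namesSierpiński p ⊥ = IsZero p
namesSierpiński p ⊤ = ¬ IsZero p

𝕊 : RepresentedSpace 0ℓ
𝕊 = record
  { points     = setoid Sierpiński
  ; names      = namesSierpiński
  ; respects   = resp
  ; functional = func
  ; surjective = surj
  }
  where
  resp : ∀ {p q x y} → p ≗ q → x ≡ y → namesSierpiński p x → namesSierpiński q y
  resp {x = ⊤} p≗q refl nz z = nz λ n → trans (p≗q n) (z n)
  resp {x = ⊥} p≗q refl z  n = trans (sym (p≗q n)) (z n)

  func : ∀ {p x y} → namesSierpiński p x → namesSierpiński p y → x ≡ y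
  func {x = ⊤} {⊤} _  _  = refl
  func {x = ⊤} {⊥} nz z  = ⊥-elim (nz z)
  func {x = ⊥} {⊤} z  nz = ⊥-elim (nz z)
  func {x = ⊥} {⊥} _  _  = refl

  surj : ∀ x → ∃ λ p → namesSierpiński p x
  surj ⊤ = (λ _ → 1) , λ z → 1+n≢0 (z 0)
  surj ⊥ = (λ _ → 0) , λ _ → refl

evens odds : Baire → Baire
evens p n = p (2 * n)
odds  p n = p (2 * n + 1)

interleave : Baire → Baire → Baire
interleave p q zero          = p 0
interleave p q (suc zero)    = q 0
interleave p q (suc (suc n)) = interleave (p ∘ suc) (q ∘ suc) n

evens-interleave : ∀ p q → p ≗ evens (interleave p q)
evens-interleave p q zero = refl
evens-interleave p q (suc n) rewrite +-suc n (n + 0) =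
  evens-interleave (p ∘ suc) (q ∘ suc) n

odds-interleave : ∀ p q → q ≗ odds (interleave p q)
odds-interleave p q zero = refl
odds-interleave p q (suc n) rewrite +-suc n (n + 0) =
  odds-interleave (p ∘ suc) (q ∘ suc) n

infixr 2 _×ᴿ_

_×ᴿ_ : RepresentedSpace a → RepresentedSpace b → RepresentedSpace (a Level.⊔ b)
X ×ᴿ Y = record
  { points     = ×-setoid (points X) (points Y)
  ; names      = λ { p (x , y) → names X (evens p) x × names Y (odds p) y }
  ; respects   = λ { p≗q (x≈ , y≈) (px , py) →
                     respects X (λ n → p≗q (2 * n)) x≈ px ,
                     respects Y (λ n → p≗q (2 * n + 1)) y≈ py }
  ; functional = λ { (px , py) (px′ , py′) → functional X px px′ , functional Y py py′ }
  ; surjective = λ { (x , y) →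
      let p , px = surjective X x
          q , qy = surjective Y y
      in interleave p q ,
         respects X (evens-interleave p q) (Setoid.refl (points X)) px ,
         respects Y (odds-interleave p q) (Setoid.refl (points Y)) qy }
  }

record Ideal (_≪_ : Rel ℕ 0ℓ) : Set₁ where
  field
    member   : Pred ℕ 0ℓ
    nonEmpty : ∃ λ x → x ∈ member
    lower    : ∀ {x y} → x ≪ y → y ∈ member → x ∈ member
    directed : ∀ {x y} → x ∈ member → y ∈ member →
               ∃ λ z → z ∈ member × x ≪ z × y ≪ z

open Ideal

Range : Baire → Pred ℕ 0ℓ
Range p x = ∃ λ n → p n ≡ x

-- Excluded middle is what makes every non-empty subset of ℕ the range of a
-- sequence, that is, what makes the representation of ideals surjective.

module _ (em : ExcludedMiddle 0ℓ) where

  enumerate : {I : Pred ℕ 0ℓ} → (∃ λ x → x ∈ I) → ∃ λ p → I ≐ Range p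
  enumerate {I} (x₀ , x₀∈I) = p , (λ {x} x∈I → x , hit x x∈I) , λ { (n , refl) → sound n }
    where
    p : Baire
    p n with em {n ∈ I}
    ... | yes _ = n
    ... | no  _ = x₀

    hit : ∀ n → n ∈ I → p n ≡ n
    hit n n∈I with em {n ∈ I}
    ... | yes _   = refl
    ... | no  n∉I = ⊥-elim (n∉I n∈I)

    sound : ∀ n → p n ∈ I
    sound n with em {n ∈ I}
    ... | yes n∈I = n∈I
    ... | no  _   = x₀∈I

  𝐈 : (_≪_ : Rel ℕ 0ℓ) → RepresentedSpace (lsuc 0ℓ)
  𝐈 _≪_ = record
    { points     = On.setoid {B = Ideal _≪_} (≐-setoid ℕ 0ℓ) member
    ; names      = λ p I → member I ≐ Range p
    ; respects   = λ { p≗q (I⊆J , J⊆I) (I⊆p , p⊆I) →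
        (λ x∈J → let n , pn≡x = I⊆p (J⊆I x∈J) in n , trans (sym (p≗q n)) pn≡x) ,
        (λ { (n , qn≡x) → I⊆J (p⊆I (n , trans (p≗q n) qn≡x)) }) }
    ; functional = λ { (I⊆p , p⊆I) (J⊆p , p⊆J) → (λ x∈I → p⊆J (I⊆p x∈I)) , (λ x∈J → p⊆I (J⊆p x∈J)) }
    ; surjective = λ I → enumerate (nonEmpty I)
    }

  PrecomputablyQuasiPolish : RepresentedSpace a → Set (lsuc 0ℓ Level.⊔ a)
  PrecomputablyQuasiPolish X = ∃ λ (_≪_ : Rel ℕ 0ℓ) →
    Transitive _≪_ × ComputablyEnumerable _≪_ × (X ≅ 𝐈 _≪_)

S-points : Pred ℕ 0ℓ → Pred (ℕ × Sierpiński) 0ℓ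
S-points A (n , ⊤) = n ∈ A
S-points A (n , ⊥) = n ∉ A

S : Pred ℕ 0ℓ → RepresentedSpace 0ℓ
S A = subspace (ℕ-space ×ᴿ 𝕊) (S-points A)

{-# OPTIONS --safe #-}
module Submission where

-- Both directions go through the equivalence of A being Δ⁰₂ with A and its
-- complement being Π₂.
--
-- Suppose that S_A ≅ 𝐈(≪). The sequence (n, b, b, …) with b ∈ {0, 1} is always a
-- name of a point of ℕ × 𝕊. That point lies in S_A iff the isomorphism maps the
-- sequence to an enumeration of an ideal, which the inverse maps back to a name
-- of the same point. This is a Π₂ condition on n; taking b = 1 and b = 0 gives A
-- and its complement.
--
-- Conversely, let A and its complement be Π₂. Take triples x = (n, flag, stage)
-- and put x ≪ y if n agrees, the flag does not drop from 1 to 0, the stage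
-- increases, and the first stage(y) instances of the Π₂ condition for n ∈ A (if y
-- is flagged) or for n ∉ A (if not) have been witnessed. An ideal has unbounded
-- stages, so the highest flag in it tells the truth about n ∈ A, and there is
-- exactly one ideal for each n.

open import Defs
open import Axiom.ExcludedMiddle using (ExcludedMiddle)
open import Data.Fin using (Fin; zero; suc; _↑ˡ_; _↑ʳ_)
open import Data.Fin.Patterns using (0F; 1F; 2F; 3F; 4F; 5F)
open import Data.Nat using (ℕ; zero; suc; pred; _+_; _*_; _∸_; _⊔_; ∣_-_∣; ⌊_/2⌋; ⌈_/2⌉; _≤_; _<_; z≤n; s≤s)
open import Data.Nat.Properties
open import Data.Product using (∃; _×_; _,_; proj₁; proj₂)
open import Data.Sum using (_⊎_; inj₁; inj₂)
open import Data.Vec using (Vec; []; _∷_; [_]; _++_; head; take; drop; lookup; map; tabulate; foldr′)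
open import Data.Vec.Properties using (lookup-++ˡ; lookup-++ʳ; take++drop≡id)
open import Data.Vec.Relation.Binary.Pointwise.Inductive as Pointwise using (Pointwise; []; _∷_)
open import Function using (_∘_; id; _⇔_; Equivalence; Inverse; mk⇔)
open import Level using (0ℓ)
open import Relation.Binary.PropositionalEquality hiding ([_])
open import Relation.Binary using (Rel; Setoid; Transitive)
open import Relation.Nullary using (¬_; Dec; yes; no; contradiction)
open import Relation.Unary using (Pred; _∈_; _≐_)
open import Relation.Unary.Relation.Binary.Equality using (≐-setoid)

private
  variable
    j k m n : ℕ

-- Total recursive functionals

record Total (j k : ℕ) : Set where
  field
    ⟦_⟧   : Vec Baire j → Vec ℕ k → ℕ
    code  : Code j k
    halts : ∀ φ xs → φ ⊢ code ⟨ xs ⟩⇓ ⟦_⟧ φ xs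

open Total

-- The code stays and only its denotation is replaced, so that later terms reduce to familiar
-- arithmetic instead of to `recursion`.
recast : (t : Total j k) (f : Vec Baire j → Vec ℕ k → ℕ) →
         (∀ φ xs → ⟦ t ⟧ φ xs ≡ f φ xs) → Total j k
recast t f t≗f = record
  { ⟦_⟧   = f
  ; code  = code t
  ; halts = λ φ xs → subst (φ ⊢ code t ⟨ xs ⟩⇓_) (t≗f φ xs) (halts t φ xs)
  }

var : Fin k → Total j k
var i = record { ⟦_⟧ = λ _ xs → lookup xs i ; code = proj i ; halts = λ _ _ → proj i }

successor : Total j 1
successor = record
  { ⟦_⟧   = λ { _ (x ∷ []) → suc x }
  ; code  = succ
  ; halts = λ { _ (x ∷ []) → succ }
  }

query : Total 1 1
query = record
  { ⟦_⟧   = λ { (p ∷ []) (x ∷ []) → p x }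
  ; code  = oracle 0F
  ; halts = λ { (p ∷ []) (x ∷ []) → oracle 0F }
  }

infix 4 _⊢_⟨_⟩⇓*_

_⊢_⟨_⟩⇓*_ : Vec Baire j → Vec (Code j k) n → Vec ℕ k → Vec ℕ n → Set
φ ⊢ gs ⟨ xs ⟩⇓* ys = Pointwise (λ g y → φ ⊢ g ⟨ xs ⟩⇓ y) gs ys

codes-halt : ∀ (us : Vec (Total j k) n) φ xs → φ ⊢ map code us ⟨ xs ⟩⇓* map (λ u → ⟦ u ⟧ φ xs) us
codes-halt []       φ xs = []
codes-halt (u ∷ us) φ xs = halts u φ xs ∷ codes-halt us φ xs

infixr 9 _∙_

_∙_ : Total j m → Vec (Total j k) m → Total j k
t ∙ us = record
  { ⟦_⟧   = λ φ xs → ⟦ t ⟧ φ (map (λ u → ⟦ u ⟧ φ xs) us)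
  ; code  = comp (code t) (map code us)
  ; halts = λ φ xs → comp (codes-halt us φ xs) (halts t φ _)
  }

const : ℕ → Total j k
const c = record { ⟦_⟧ = λ _ _ → c ; code = numeral c ; halts = λ _ _ → go c }
  where
  numeral : ℕ → Code j k
  numeral zero    = zer
  numeral (suc c) = comp succ [ numeral c ]

  go : ∀ c {φ : Vec Baire j} {xs} → φ ⊢ numeral {k = k} c ⟨ xs ⟩⇓ c
  go zero    = zer
  go (suc c) = comp (go c ∷ []) succ

recursion : (Vec ℕ k → ℕ) → (Vec ℕ (2 + k) → ℕ) → Vec ℕ (1 + k) → ℕ
recursion f g (zero  ∷ xs) = f xs
recursion f g (suc i ∷ xs) = g (i ∷ recursion f g (i ∷ xs) ∷ xs)

primrec : Total j k → Total j (2 + k) → Total j (1 + k)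
primrec t u = record
  { ⟦_⟧   = λ φ → recursion (⟦ t ⟧ φ) (⟦ u ⟧ φ)
  ; code  = prec (code t) (code u)
  ; halts = λ { φ (i ∷ xs) → go φ i xs }
  }
  where
  go : ∀ φ i xs → φ ⊢ prec (code t) (code u) ⟨ i ∷ xs ⟩⇓ recursion (⟦ t ⟧ φ) (⟦ u ⟧ φ) (i ∷ xs)
  go φ zero    xs = prec-z (halts t φ xs)
  go φ (suc i) xs = prec-s (go φ i xs) (halts u φ _)

-- Arithmetic and case distinction by primitive recursion

predecessor : Total j 1
predecessor = recast (primrec (const 0) (var 0F)) (λ { _ (x ∷ []) → pred x })
  λ { _ (zero ∷ []) → refl ; _ (suc x ∷ []) → refl }

addition : Total j 2
addition = recast (primrec (var 0F) (successor ∙ [ var 1F ])) (λ { _ (x ∷ y ∷ []) → x + y })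
  λ { φ (x ∷ y ∷ []) → go φ x y }
  where
  go : ∀ φ x y → ⟦ primrec (var 0F) (successor ∙ [ var 1F ]) ⟧ φ (x ∷ y ∷ []) ≡ x + y
  go φ zero    y = refl
  go φ (suc x) y = cong suc (go φ x y)

multiplication : Total j 2
multiplication = recast t (λ { _ (x ∷ y ∷ []) → x * y }) λ { φ (x ∷ y ∷ []) → go φ x y }
  where
  t : Total j 2
  t = primrec (const 0) (addition ∙ (var 2F ∷ var 1F ∷ []))

  go : ∀ (φ : Vec Baire j) x y → ⟦ t ⟧ φ (x ∷ y ∷ []) ≡ x * y
  go φ zero    y = refl
  go φ (suc x) y = cong (y +_) (go φ x y)

subtraction : Total j 2
subtraction = recast (t ∙ (var 1F ∷ var 0F ∷ [])) (λ { _ (x ∷ y ∷ []) → x ∸ y })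
  λ { φ (x ∷ y ∷ []) → go φ x y }
  where
  t : Total j 2
  t = primrec (var 0F) (predecessor ∙ [ var 1F ])

  go : ∀ (φ : Vec Baire j) x y → ⟦ t ⟧ φ (y ∷ x ∷ []) ≡ x ∸ y
  go φ x zero    = refl
  go φ x (suc y) = trans (cong pred (go φ x y)) (pred[m∸n]≡m∸[1+n] x y)

ifZero : ℕ → ℕ → ℕ → ℕ
ifZero zero    x y = x
ifZero (suc _) x y = y

conditional : Total j 3
conditional = recast (primrec (var 0F) (var 3F)) (λ { _ (c ∷ x ∷ y ∷ []) → ifZero c x y })
  λ { _ (zero ∷ x ∷ y ∷ []) → refl ; _ (suc c ∷ x ∷ y ∷ []) → refl }

-- With 0 read as undefined, this is strictness in the first argument; with 0 read as a passed test,
-- it makes the test vacuous while that argument is undefined.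
guard : ℕ → ℕ → ℕ
guard zero    _ = 0
guard (suc _) y = y

guarding : Total j 2
guarding = recast (conditional ∙ (var 0F ∷ const 0 ∷ var 1F ∷ [])) (λ { _ (x ∷ y ∷ []) → guard x y })
  λ { _ (zero ∷ y ∷ []) → refl ; _ (suc x ∷ y ∷ []) → refl }

distance : Total j 2
distance = recast
  (addition ∙ (subtraction ∷ subtraction ∙ (var 1F ∷ var 0F ∷ []) ∷ []))
  (λ { _ (x ∷ y ∷ []) → ∣ x - y ∣ }) λ { _ (x ∷ y ∷ []) → go x y }
  where
  go : ∀ x y → (x ∸ y) + (y ∸ x) ≡ ∣ x - y ∣
  go zero    zero    = refl
  go zero    (suc y) = refl
  go (suc x) zero    = cong suc (+-identityʳ x)
  go (suc x) (suc y) = go x y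

halving : Total j 1
halving = recast t (λ { _ (x ∷ []) → ⌊ x /2⌋ }) λ { φ (x ∷ []) → go φ x }
  where
  t : Total j 1
  -- The recursion is ⌊(x + 1)/2⌋ = x - ⌊x/2⌋.
  t = primrec (const 0) subtraction

  go : ∀ (φ : Vec Baire j) x → ⟦ t ⟧ φ [ x ] ≡ ⌊ x /2⌋
  go φ zero    = refl
  go φ (suc x) = begin
    x ∸ ⟦ t ⟧ φ [ x ]               ≡⟨ cong (x ∸_) (go φ x) ⟩
    x ∸ ⌊ x /2⌋                     ≡⟨ cong (_∸ ⌊ x /2⌋) (⌊n/2⌋+⌈n/2⌉≡n x) ⟨
    ⌊ x /2⌋ + ⌈ x /2⌉ ∸ ⌊ x /2⌋     ≡⟨ m+n∸m≡n ⌊ x /2⌋ ⌈ x /2⌉ ⟩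
    ⌈ x /2⌉                         ∎
    where open ≡-Reasoning

-- Integer square root and pairing

root : ℕ → ℕ
root zero    = 0
-- The root grows by one exactly when the next square is at most n + 1, which is when the truncated
-- difference vanishes.
root (suc n) = ifZero (suc (root n) * suc (root n) ∸ suc n) (suc (root n)) (root n)

rooting : Total j 1
rooting = recast t (λ { _ (x ∷ []) → root x }) λ { φ (x ∷ []) → go φ x }
  where
  t : Total j 1
  t = primrec (const 0) (conditional ∙
        ( subtraction ∙
            ( multiplication ∙ (successor ∙ [ var 1F ] ∷ successor ∙ [ var 1F ] ∷ [])
            ∷ successor ∙ [ var 0F ] ∷ [])
        ∷ successor ∙ [ var 1F ]
        ∷ var 1F ∷ []))

  go : ∀ (φ : Vec Baire j) x → ⟦ t ⟧ φ [ x ] ≡ root x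
  go φ zero    = refl
  go φ (suc x) rewrite go φ x = refl

root-bounds : ∀ n → root n * root n ≤ n × n < suc (root n) * suc (root n)
root-bounds zero = z≤n , s≤s z≤n
root-bounds (suc n)
  with suc (root n) * suc (root n) ∸ suc n in eq | root-bounds n
... | zero  | _ , n<  = m∸n≡0⇒m≤n eq , ≤-<-trans n< (*-mono-< (n<1+n (suc (root n))) (n<1+n (suc (root n))))
... | suc _ | ≤n , _  = m≤n⇒m≤1+n ≤n , m∸n≢0⇒n<m λ eq₀ → contradiction (trans (sym eq₀) eq) λ ()

root-unique : ∀ {n r} → r * r ≤ n → n < suc r * suc r → root n ≡ r
root-unique {n} {r} r²≤n n<r² =
  ≤-antisym (below (≤-<-trans (proj₁ (root-bounds n)) n<r²))
            (below (≤-<-trans r²≤n (proj₂ (root-bounds n))))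
  where
  below : ∀ {a b} → a * a < suc b * suc b → a ≤ b
  below {a} {b} a²<b² with a ≤? b
  ... | yes a≤b = a≤b
  ... | no  a≰b = contradiction a²<b² (≤⇒≯ (*-mono-≤ (≰⇒> a≰b) (≰⇒> a≰b)))

-- Every number is r² + a with a ≤ 2r, and those with a ≤ r encode the pair
-- (a , r − a).

opaque
  pair : ℕ → ℕ → ℕ
  pair a b = (a + b) * (a + b) + a

  fst snd : ℕ → ℕ
  fst n = n ∸ root n * root n
  snd n = root n ∸ fst n

  -- The definitions do not unfold outside the opaque block; these equations let `pairing`, `first`
  -- and `second` supply codes for them.
  pair-def : ∀ a b → (a + b) * (a + b) + a ≡ pair a b
  pair-def a b = refl

  fst-def : ∀ n → n ∸ root n * root n ≡ fst n
  fst-def n = refl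

  snd-def : ∀ n → root n ∸ fst n ≡ snd n
  snd-def n = refl

  root-pair : ∀ a b → root (pair a b) ≡ a + b
  root-pair a b = root-unique {r = a + b} (m≤m+n _ a) (begin-strict
    (a + b) * (a + b) + a            ≤⟨ +-monoʳ-≤ _ (m≤m+n a b) ⟩
    (a + b) * (a + b) + (a + b)      ≡⟨ +-comm _ (a + b) ⟩
    suc (a + b) * (a + b)            ≡⟨ *-comm (suc (a + b)) (a + b) ⟩
    (a + b) * suc (a + b)            <⟨ *-monoˡ-< (suc (a + b)) (n<1+n (a + b)) ⟩
    suc (a + b) * suc (a + b)        ∎)
    where open ≤-Reasoning

  fst-pair : ∀ a b → fst (pair a b) ≡ a
  fst-pair a b rewrite root-pair a b = m+n∸m≡n ((a + b) * (a + b)) a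

  snd-pair : ∀ a b → snd (pair a b) ≡ b
  snd-pair a b rewrite root-pair a b | m+n∸m≡n ((a + b) * (a + b)) a = m+n∸m≡n a b

pairing : Total j 2
pairing = recast
  (addition ∙ (multiplication ∙ (addition ∷ addition ∷ []) ∷ var 0F ∷ []))
  (λ { _ (a ∷ b ∷ []) → pair a b }) λ { _ (a ∷ b ∷ []) → pair-def a b }

first second : Total j 1
first = recast (subtraction ∙ (var 0F ∷ multiplication ∙ (rooting ∷ rooting ∷ []) ∷ []))
  (λ { _ (x ∷ []) → fst x }) λ { _ (x ∷ []) → fst-def x }
second = recast (subtraction ∙ (rooting ∷ first ∷ []))
  (λ { _ (x ∷ []) → snd x }) λ { _ (x ∷ []) → snd-def x }

-- Evaluation with bounded fuel

-- The value 0 means that no result was found within the fuel s, and suc y that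
-- the result is y. In the search for a zero, the state is 0 after meeting an
-- undefined value, 1 while searching, and 2 + y on success.

step : ℕ → ℕ → ℕ → ℕ
step 1 0             t = 0
step 1 1             t = 2 + t
step 1 (suc (suc _)) t = 1
step r _             _ = r

search : (ℕ → ℕ) → ℕ → ℕ
search h zero    = 1
search h (suc t) = step (search h t) (h t) t

guards : Vec ℕ m → ℕ → ℕ
guards ys z = foldr′ guard z ys

mutual
  -- Fuel bounds only the searches of `μ`; everything else is structural recursion, so `evalCode`
  -- can mirror the evaluation with `prec` in place of each search.
  eval : Code j k → (Fin j → Baire) → ℕ → Vec ℕ k → ℕ
  eval zer         o s xs       = 1
  eval succ        o s (x ∷ []) = 2 + x
  eval (proj i)    o s xs       = suc (lookup xs i)
  eval (oracle i)  o s (x ∷ []) = o i x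
  eval (comp f gs) o s xs       = guards (evals gs o s xs) (eval f o s (map pred (evals gs o s xs)))
  eval (prec f g)  o s xs       =
    recursion (eval f o s) (λ { (i ∷ y ∷ zs) → guard y (eval g o s (i ∷ pred y ∷ zs)) }) xs
  -- `pred` sends the states 0 and 1 to undefined, and 2 + y to suc y, the encoding of the result y.
  eval (μ f)       o s xs       = pred (search (λ i → eval f o s (i ∷ xs)) s)

  evals : Vec (Code j k) m → (Fin j → Baire) → ℕ → Vec ℕ k → Vec ℕ m
  evals []       o s xs = []
  evals (g ∷ gs) o s xs = eval g o s xs ∷ evals gs o s xs

stepping : Total j 3
stepping = recast
  (conditional ∙ (var 0F ∷ const 0 ∷
    conditional ∙ (predecessor ∙ [ var 0F ] ∷
      conditional ∙ (var 1F ∷ const 0 ∷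
        conditional ∙ (predecessor ∙ [ var 1F ] ∷
          addition ∙ (const 2 ∷ var 2F ∷ []) ∷ const 1 ∷ []) ∷ []) ∷
      var 0F ∷ []) ∷ []))
  (λ { _ (r ∷ v ∷ t ∷ []) → step r v t })
  λ { _ (0 ∷ _ ∷ _ ∷ [])               → refl
    ; _ (1 ∷ 0 ∷ _ ∷ [])               → refl
    ; _ (1 ∷ 1 ∷ _ ∷ [])               → refl
    ; _ (1 ∷ suc (suc _) ∷ _ ∷ [])     → refl
    ; _ (suc (suc _) ∷ _ ∷ _ ∷ [])     → refl }

projs : (Fin m → Fin n) → Vec (Code j n) m
projs ρ = tabulate λ i → proj (ρ i)

projs-halt : {φ : Vec Baire j} (ρ : Fin m → Fin n) (xs : Vec ℕ m) (ys : Vec ℕ n) →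
             (∀ i → lookup ys (ρ i) ≡ lookup xs i) →
             φ ⊢ projs ρ ⟨ ys ⟩⇓* xs
projs-halt ρ []       ys eq = []
projs-halt {φ = φ} ρ (x ∷ xs) ys eq =
  subst (φ ⊢ proj (ρ 0F) ⟨ ys ⟩⇓_) (eq 0F) (proj (ρ 0F)) ∷ projs-halt (ρ ∘ suc) xs ys (eq ∘ suc)

predCode : Code j k → Code j k
predCode c = comp (code predecessor) [ c ]

predCode-halts : ∀ {φ : Vec Baire j} {c : Code j k} {xs y} →
                 φ ⊢ c ⟨ xs ⟩⇓ y → φ ⊢ predCode c ⟨ xs ⟩⇓ pred y
predCode-halts d = comp (d ∷ []) (halts predecessor _ _)

predCodes-halt : ∀ {φ : Vec Baire j} {cs : Vec (Code j k) n} {xs ys} →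
                 φ ⊢ cs ⟨ xs ⟩⇓* ys → φ ⊢ map predCode cs ⟨ xs ⟩⇓* map pred ys
predCodes-halt []       = []
predCodes-halt (d ∷ ds) = predCode-halts d ∷ predCodes-halt ds

guardsCode : Vec (Code j k) n → Code j k → Code j k
guardsCode []       d = d
guardsCode (c ∷ cs) d = comp (code guarding) (c ∷ guardsCode cs d ∷ [])

guardsCode-halts : ∀ {φ : Vec Baire j} {cs : Vec (Code j k) n} {c xs ys y} →
                   φ ⊢ cs ⟨ xs ⟩⇓* ys → φ ⊢ c ⟨ xs ⟩⇓ y →
                   φ ⊢ guardsCode cs c ⟨ xs ⟩⇓ guards ys y
guardsCode-halts []       e = e
guardsCode-halts (d ∷ ds) e = comp (d ∷ guardsCode-halts ds e ∷ []) (halts guarding _ _)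

dropSecond : Fin (1 + k) → Fin (2 + k)
dropSecond zero    = zero
dropSecond (suc i) = suc (suc i)

lookup-dropSecond : ∀ i y (xs : Vec ℕ k) l →
                    lookup (i ∷ y ∷ xs) (dropSecond l) ≡ lookup (i ∷ xs) l
lookup-dropSecond i y xs zero    = refl
lookup-dropSecond i y xs (suc l) = refl

-- The arguments of evalCode e are those of e followed by the fuel and the
-- parameters on which the approximations G to the oracles depend.

module _ {j m} (G : Fin j → Total 0 (2 + m)) where

  mutual
    evalCode : Code j k → Code 0 (k + suc m)
    evalCode zer        = code (const 1)
    evalCode succ       = comp succ [ comp succ [ proj 0F ] ]
    evalCode (proj i)   = comp succ [ proj (i ↑ˡ suc m) ]
    evalCode (oracle i) = code (G i)
    evalCode {k} (comp f gs) = guardsCode (evalCodes gs)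
      (comp (evalCode f) (map predCode (evalCodes gs) ++ projs (k ↑ʳ_)))
    evalCode (prec f g) = prec (evalCode f)
      (guardsCode [ proj 1F ]
        (comp (evalCode g) (proj 0F ∷ predCode (proj 1F) ∷ projs (2 ↑ʳ_))))
    evalCode {k} (μ f) = predCode
      -- The search is a primitive recursion whose counter is the fuel, found just after the k
      -- arguments; `dropSecond` removes the search state before `f` is called.
      (comp (prec (code (const 1))
                  (comp (code stepping)
                        (proj 1F ∷ comp (evalCode f) (projs dropSecond) ∷ proj 0F ∷ [])))
            (proj (k ↑ʳ 0F) ∷ projs id))

    evalCodes : Vec (Code j k) n → Vec (Code 0 (k + suc m)) n
    evalCodes []       = []
    evalCodes (g ∷ gs) = evalCode g ∷ evalCodes gs

  module _ (s : ℕ) (qs : Vec ℕ m) where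

    private
      ps : Vec ℕ (suc m)
      ps = s ∷ qs

      approx : Fin j → Baire
      approx i x = ⟦ G i ⟧ [] (x ∷ ps)

    mutual
      evalCode-halts : (e : Code j k) (xs : Vec ℕ k) →
                       [] ⊢ evalCode e ⟨ xs ++ ps ⟩⇓ eval e approx s xs
      evalCode-halts zer        xs       = halts (const 1) [] _
      evalCode-halts succ       (x ∷ []) = comp (comp (proj 0F ∷ []) succ ∷ []) succ
      evalCode-halts (proj i)   xs       = comp
        (subst ([] ⊢ proj (i ↑ˡ suc m) ⟨ xs ++ ps ⟩⇓_) (lookup-++ˡ xs ps i) (proj _) ∷ []) succ
      evalCode-halts (oracle i) (x ∷ []) = halts (G i) [] (x ∷ ps)
      evalCode-halts {k} (comp f gs) xs = guardsCode-halts (evalCodes-halt gs xs)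
        (comp (Pointwise.++⁺ (predCodes-halt (evalCodes-halt gs xs))
                             (projs-halt (k ↑ʳ_) ps (xs ++ ps) (lookup-++ʳ xs ps)))
              (evalCode-halts f _))
      evalCode-halts (prec f g) (i ∷ xs) = go i
        where
        go : ∀ i → [] ⊢ evalCode (prec f g) ⟨ i ∷ xs ++ ps ⟩⇓ eval (prec f g) approx s (i ∷ xs)
        go zero    = prec-z (evalCode-halts f xs)
        go (suc i) = prec-s (go i) (guardsCode-halts (proj 1F ∷ [])
          (comp (proj 0F ∷ predCode-halts (proj 1F) ∷ projs-halt (2 ↑ʳ_) (xs ++ ps) _ λ _ → refl)
                (evalCode-halts g (_ ∷ _ ∷ xs))))
      evalCode-halts {k} (μ f) xs = predCode-halts
        (comp (subst ([] ⊢ proj (k ↑ʳ 0F) ⟨ xs ++ ps ⟩⇓_) (lookup-++ʳ xs ps 0F) (proj _) ∷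
               projs-halt id (xs ++ ps) _ (λ _ → refl))
              (go s))
        where
        go : ∀ t → [] ⊢ _ ⟨ t ∷ xs ++ ps ⟩⇓ search (λ i → eval f approx s (i ∷ xs)) t
        go zero    = prec-z (halts (const 1) [] _)
        go (suc t) = prec-s (go t)
          (comp (proj 1F ∷
                 comp (projs-halt dropSecond (t ∷ xs ++ ps) _ (lookup-dropSecond t _ (xs ++ ps)))
                      (evalCode-halts f (t ∷ xs)) ∷
                 proj 0F ∷ [])
                (halts stepping [] _))

      evalCodes-halt : (gs : Vec (Code j k) n) (xs : Vec ℕ k) →
                       [] ⊢ evalCodes gs ⟨ xs ++ ps ⟩⇓* evals gs approx s xs
      evalCodes-halt []       xs = []
      evalCodes-halt (g ∷ gs) xs = evalCode-halts g xs ∷ evalCodes-halt gs xs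

  evaluator : Code j k → Total 0 (k + suc m)
  evaluator {k} e = record
    { ⟦_⟧   = value
    ; code  = evalCode e
    ; halts = λ { [] xs → subst (λ ys → [] ⊢ evalCode e ⟨ ys ⟩⇓ value [] xs) (take++drop≡id k xs)
                                (at (take k xs) (drop k xs)) }
    }
    where
    value : Vec Baire 0 → Vec ℕ (k + suc m) → ℕ
    value _ xs = eval e (λ i x → ⟦ G i ⟧ [] (x ∷ drop k xs)) (head (drop k xs)) (take k xs)

    at : ∀ xs ps → [] ⊢ evalCode e ⟨ xs ++ ps ⟩⇓ eval e (λ i x → ⟦ G i ⟧ [] (x ∷ ps)) (head ps) xs
    at xs (s ∷ ps) = evalCode-halts s ps e xs

-- Soundness and completeness of the evaluation

search-continued : ∀ h t → search h t ≡ 1 → ∀ i → i < t → ∃ λ v → h i ≡ 2 + v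
search-continued h (suc t) eq i i<1+t with search h t in eqₜ | h t in eqₕ
search-continued h (suc t) eq i i<1+t | 1 | suc (suc v) with m<1+n⇒m<n∨m≡n i<1+t
... | inj₁ i<t  = search-continued h t eqₜ i i<t
... | inj₂ refl = v , eqₕ

search-found : ∀ h t {y} → search h t ≡ 2 + y → h y ≡ 1 × (∀ i → i < y → ∃ λ v → h i ≡ 2 + v)
search-found h (suc t) eq with search h t in eqₜ | h t in eqₕ
search-found h (suc t) eq   | suc (suc _) | _ = search-found h t (trans eqₜ eq)
search-found h (suc t) refl | 1           | 1 = eqₕ , search-continued h t eqₜ

search-continues : ∀ h t → (∀ i → i < t → ∃ λ v → h i ≡ 2 + v) → search h t ≡ 1
search-continues h zero    _   = refl
search-continues h (suc t) h≥2
  rewrite search-continues h t (λ i i<t → h≥2 i (m<n⇒m<1+n i<t)) | proj₂ (h≥2 t (n<1+n t)) = refl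

search-finds : ∀ h {y} → (∀ i → i < y → ∃ λ v → h i ≡ 2 + v) → h y ≡ 1 →
               ∀ t → y < t → search h t ≡ 2 + y
search-finds h h≥2 hy≡1 (suc t) y<1+t with m<1+n⇒m<n∨m≡n y<1+t
... | inj₁ y<t  rewrite search-finds h h≥2 hy≡1 t y<t = refl
... | inj₂ refl rewrite search-continues h t h≥2 | hy≡1 = refl

guard-suc : ∀ x {y z} → guard x y ≡ suc z → x ≡ suc (pred x) × y ≡ suc z
guard-suc (suc x) eq = refl , eq

module _ {φ : Vec Baire j} {o : Fin j → Baire} (s : ℕ)
         (o-sound : ∀ i x {v} → o i x ≡ suc v → lookup φ i x ≡ v) where
  mutual
    -- The guards make a positive value depend on every subevaluation being defined, so a halting
    -- derivation can be rebuilt from these.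
    eval-sound : (e : Code j k) (xs : Vec ℕ k) → ∀ {y} → eval e o s xs ≡ suc y → φ ⊢ e ⟨ xs ⟩⇓ y
    eval-sound zer         xs       refl = zer
    eval-sound succ        (x ∷ []) refl = succ
    eval-sound (proj i)    xs       refl = proj i
    eval-sound (oracle i)  (x ∷ []) eq   = subst (φ ⊢ oracle i ⟨ [ x ] ⟩⇓_) (o-sound i x eq) (oracle i)
    eval-sound (comp f gs) xs       eq   with ds , eq′ ← evals-sound gs xs eq =
      comp ds (eval-sound f _ eq′)
    eval-sound (prec f g)  (i ∷ xs) eq   = go i eq
      where
      go : ∀ i {y} → eval (prec f g) o s (i ∷ xs) ≡ suc y → φ ⊢ prec f g ⟨ i ∷ xs ⟩⇓ y
      go zero    eq = prec-z (eval-sound f xs eq)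
      go (suc i) eq with eqᵢ , eq′ ← guard-suc (eval (prec f g) o s (i ∷ xs)) eq =
        prec-s (go i eqᵢ) (eval-sound g _ eq′)
    eval-sound (μ f)       xs       eq
      with search (λ i → eval f o s (i ∷ xs)) s in eqₛ
    eval-sound (μ f) xs refl | suc (suc y)
      with fy , f< ← search-found (λ i → eval f o s (i ∷ xs)) s eqₛ =
      μ (eval-sound f _ fy) λ i i<y → let v , fi = f< i i<y in v , eval-sound f _ fi

    evals-sound : (gs : Vec (Code j k) n) (xs : Vec ℕ k) → ∀ {y z} →
                  guards (evals gs o s xs) z ≡ suc y →
                  φ ⊢ gs ⟨ xs ⟩⇓* map pred (evals gs o s xs) × z ≡ suc y
    evals-sound []       xs eq = [] , eq
    evals-sound (g ∷ gs) xs eq with eval g o s xs in eqᵍ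
    ... | suc v with ds , eq′ ← evals-sound gs xs eq = eval-sound g xs eqᵍ ∷ ds , eq′

-- Takes the place of monotonicity in the fuel: finitely many eventual facts hold together from some
-- fuel on.
Eventually : Pred ℕ 0ℓ → Set
Eventually P = ∃ λ N → ∀ s → N ≤ s → P s

always : ∀ {P : Pred ℕ 0ℓ} → (∀ s → P s) → Eventually P
always p = 0 , λ s _ → p s

zip : ∀ {P Q R : Pred ℕ 0ℓ} → (∀ {s} → P s → Q s → R s) → Eventually P → Eventually Q → Eventually R
zip f (M , p) (N , q) = M ⊔ N , λ s M⊔N≤s → f (p s (m⊔n≤o⇒m≤o M N M⊔N≤s)) (q s (m⊔n≤o⇒n≤o M N M⊔N≤s))

all-below : ∀ {P : ℕ → Pred ℕ 0ℓ} y → (∀ i → i < y → Eventually (P i)) →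
            Eventually λ s → ∀ i → i < y → P i s
all-below     zero    p = always λ _ _ ()
all-below {P} (suc y) p = zip extend (all-below y λ i i<y → p i (m<n⇒m<1+n i<y)) (p y (n<1+n y))
  where
  extend : ∀ {s} → (∀ i → i < y → P i s) → P y s → ∀ i → i < suc y → P i s
  extend below at i i<1+y with m<1+n⇒m<n∨m≡n i<1+y
  ... | inj₁ i<y  = below i i<y
  ... | inj₂ refl = at

module _ {φ : Vec Baire j} {o : ℕ → Fin j → Baire}
         (o-complete : ∀ i x → Eventually λ s → o s i x ≡ suc (lookup φ i x)) where
  mutual
    -- A halting derivation involves finitely many oracle queries and search steps, so any
    -- sufficiently large fuel covers them all.
    eval-complete : ∀ {e : Code j k} {xs y} → φ ⊢ e ⟨ xs ⟩⇓ y →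
                    Eventually λ s → eval e (o s) s xs ≡ suc y
    eval-complete zer        = always λ _ → refl
    eval-complete succ       = always λ _ → refl
    eval-complete (proj i)   = always λ _ → refl
    eval-complete (oracle i) = o-complete i _
    eval-complete {xs = xs} (comp {f = f} {gs = gs} ds d) =
      zip (λ {s} → join s) (evals-complete ds) (eval-complete d)
      where
      join : ∀ s {ys z} → evals gs (o s) s xs ≡ map suc ys → eval f (o s) s ys ≡ suc z →
             guards (evals gs (o s) s xs) (eval f (o s) s (map pred (evals gs (o s) s xs))) ≡ suc z
      join s {ys} gs≡ f≡ rewrite gs≡ = trans (guards-suc ys) (trans (cong (eval f (o s) s) (pred-suc ys)) f≡)
        where
        guards-suc : ∀ {n w} (ys : Vec ℕ n) → guards (map suc ys) w ≡ w
        guards-suc []       = refl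
        guards-suc (y ∷ ys) = guards-suc ys

        pred-suc : ∀ {n} (ys : Vec ℕ n) → map pred (map suc ys) ≡ ys
        pred-suc []       = refl
        pred-suc (y ∷ ys) = cong (y ∷_) (pred-suc ys)
    eval-complete (prec-z d) = eval-complete d
    eval-complete (prec-s {g = g} {xs} {i} d d′) =
      zip (λ {s} eq → trans (cong (λ r → guard r (eval g (o s) s (i ∷ pred r ∷ xs))) eq))
          (eval-complete d) (eval-complete d′)
    eval-complete (μ {f = f} {xs} {y} d ds) =
      zip (λ { {s} f≡ (y<s , f<) → cong pred (search-finds _ f< f≡ s y<s) })
        (eval-complete d)
        -- The search inspects only candidates below the fuel, which must therefore exceed y.
        (zip _,_ (suc y , λ _ y<s → y<s)
                 (all-below {P = λ i s → ∃ λ v → eval f (o s) s (i ∷ xs) ≡ 2 + v} y λ i i<y →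
                   let N , p = eval-complete (proj₂ (ds i i<y)) in N , λ s N≤s → _ , p s N≤s))

    evals-complete : ∀ {gs : Vec (Code j k) n} {xs ys} → φ ⊢ gs ⟨ xs ⟩⇓* ys →
                     Eventually λ s → evals gs (o s) s xs ≡ map suc ys
    evals-complete []       = always λ _ → refl
    evals-complete (d ∷ ds) = zip (cong₂ _∷_) (eval-complete d) (evals-complete ds)

-- With the exact oracles in place of approximations, both outputs are the value of one evaluation
-- at a common large fuel.
deterministic : ∀ {φ : Vec Baire j} {e : Code j k} {xs y z} →
                φ ⊢ e ⟨ xs ⟩⇓ y → φ ⊢ e ⟨ xs ⟩⇓ z → y ≡ z
deterministic {φ = φ} d d′ =
  let N , eq = zip (λ eq eq′ → suc-injective (trans (sym eq) eq′)) (eval-complete exact d) (eval-complete exact d′)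
  in eq N ≤-refl
  where
  exact : ∀ i x → Eventually λ _ → suc (lookup φ i x) ≡ suc (lookup φ i x)
  exact i x = always λ _ → refl

-- Π₂ predicates

unpack : ∀ k → ℕ → Vec ℕ k
unpack zero    x = []
unpack (suc k) x = fst x ∷ unpack k (snd x)

unpack-surjective : (xs : Vec ℕ k) → ∃ λ x → unpack k x ≡ xs
unpack-surjective []       = 0 , refl
unpack-surjective (x ∷ xs) with y , refl ← unpack-surjective xs =
  pair x y , cong₂ _∷_ (fst-pair x y) (cong (unpack _) (snd-pair x y))

unpacking : ∀ k → Total j m → Vec (Total j m) k
unpacking zero    t = []
unpacking (suc k) t = first ∙ [ t ] ∷ unpacking k (second ∙ [ t ])

map-unpacking : ∀ k (t : Total j m) (us : Vec (Total j m) n) φ xs →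
                map (λ u → ⟦ u ⟧ φ xs) (unpacking k t ++ us) ≡
                unpack k (⟦ t ⟧ φ xs) ++ map (λ u → ⟦ u ⟧ φ xs) us
map-unpacking zero    t us φ xs = refl
map-unpacking (suc k) t us φ xs = cong (_ ∷_) (map-unpacking k (second ∙ [ t ]) us φ xs)

-- Test functions take the value 0 when the tested condition holds.

Π₂ : Pred ℕ 0ℓ → Set
Π₂ R = ∃ λ (t : Total 0 3) → ∀ n → R n ⇔ (∀ y → ∃ λ z → ⟦ t ⟧ [] (z ∷ y ∷ n ∷ []) ≡ 0)

AllExist : ∀ a b → Total 0 (a + (b + 1)) → Pred ℕ 0ℓ
AllExist a b t n = (ys : Vec ℕ b) → ∃ λ (zs : Vec ℕ a) → ⟦ t ⟧ [] (zs ++ ys ++ [ n ]) ≡ 0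

-- Each block of quantifiers is contracted to a single one over a packed number; surjectivity of
-- `unpack` ensures that no vector is missed.
allExist-Π₂ : ∀ a b t → Π₂ (AllExist a b t)
allExist-Π₂ a b t = t′ , λ n → mk⇔ packed unpacked
  where
  t′ : Total 0 3
  t′ = recast (t ∙ (unpacking a (var 0F) ++ unpacking b (var 1F) ++ [ var 2F ]))
    (λ { φ (z ∷ y ∷ n ∷ []) → ⟦ t ⟧ φ (unpack a z ++ unpack b y ++ [ n ]) })
    λ { φ (z ∷ y ∷ n ∷ []) → cong (⟦ t ⟧ φ) (trans
      (map-unpacking a (var 0F) _ φ (z ∷ y ∷ n ∷ []))
      (cong (unpack a z ++_) (map-unpacking b (var 1F) _ φ (z ∷ y ∷ n ∷ [])))) }

  packed : AllExist a b t n → ∀ y → ∃ λ z → ⟦ t′ ⟧ [] (z ∷ y ∷ n ∷ []) ≡ 0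
  packed {n} ae y =
    let zs , eq = ae (unpack b y)
        z , unpack≡ = unpack-surjective zs
    in z , subst (λ zs → ⟦ t ⟧ [] (zs ++ unpack b y ++ [ n ]) ≡ 0) (sym unpack≡) eq

  unpacked : (∀ y → ∃ λ z → ⟦ t′ ⟧ [] (z ∷ y ∷ n ∷ []) ≡ 0) → AllExist a b t n
  unpacked {n} ae ys =
    let y , unpack≡ = unpack-surjective ys
        z , eq = ae y
    in unpack a z , subst (λ ys → ⟦ t ⟧ [] (unpack a z ++ ys ++ [ n ]) ≡ 0) unpack≡ eq

+≡0 : ∀ x {y} → x + y ≡ 0 → x ≡ 0 × y ≡ 0
+≡0 x eq = m+n≡0⇒m≡0 x eq , m+n≡0⇒n≡0 x eq

-- The two witnesses are paired, and a sum vanishes exactly when both summands do.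
Π₂-× : ∀ {P Q} → Π₂ P → Π₂ Q → Π₂ (λ n → P n × Q n)
Π₂-× {P} {Q} (t , P⇔) (u , Q⇔) = v , λ n → mk⇔ paired λ v≡0 →
  Equivalence.from (P⇔ n) (λ y → let z , eq = v≡0 y in fst z , proj₁ (+≡0 _ eq)) ,
  Equivalence.from (Q⇔ n) (λ y → let z , eq = v≡0 y in snd z , proj₂ (+≡0 (⟦ t ⟧ [] (fst z ∷ y ∷ n ∷ [])) eq))
  where
  v : Total 0 3
  v = addition ∙ ( t ∙ (first  ∙ [ var 0F ] ∷ var 1F ∷ var 2F ∷ [])
                 ∷ u ∙ (second ∙ [ var 0F ] ∷ var 1F ∷ var 2F ∷ []) ∷ [])

  paired : P n × Q n → ∀ y → ∃ λ z → ⟦ v ⟧ [] (z ∷ y ∷ n ∷ []) ≡ 0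
  paired {n} (p , q) y =
    let z , t≡0 = Equivalence.to (P⇔ n) p y
        w , u≡0 = Equivalence.to (Q⇔ n) q y
    in pair z w , cong₂ _+_
         (trans (cong (λ z → ⟦ t ⟧ [] (z ∷ y ∷ n ∷ [])) (fst-pair z w)) t≡0)
         (trans (cong (λ w → ⟦ u ⟧ [] (w ∷ y ∷ n ∷ [])) (snd-pair z w)) u≡0)

Π₂-resp : ∀ {P Q} → (∀ n → P n ⇔ Q n) → Π₂ P → Π₂ Q
Π₂-resp P⇔Q (t , P⇔) = t , λ n → mk⇔
  (Equivalence.to (P⇔ n) ∘ Equivalence.from (P⇔Q n))
  (Equivalence.to (P⇔Q n) ∘ Equivalence.from (P⇔ n))

-- Comparison with the arithmetical hierarchy

recursive-≡0 : (t : Total 0 k) → Recursive (λ xs → ⟦ t ⟧ [] xs ≡ 0)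
recursive-≡0 t = code u , λ xs → decided xs (⟦ t ⟧ [] xs) refl
  where
  u = conditional ∙ (t ∷ const 1 ∷ const 0 ∷ [])

  decided : ∀ xs v → ⟦ t ⟧ [] xs ≡ v →
            (⟦ t ⟧ [] xs ≡ 0 × [] ⊢ code u ⟨ xs ⟩⇓ 1) ⊎ (⟦ t ⟧ [] xs ≢ 0 × [] ⊢ code u ⟨ xs ⟩⇓ 0)
  decided xs zero    eq = inj₁ (eq , subst (λ v → [] ⊢ code u ⟨ xs ⟩⇓ ifZero v 1 0) eq (halts u [] xs))
  decided xs (suc v) eq = inj₂ ( (λ eq₀ → 1+n≢0 (trans (sym eq) eq₀))
                               , subst (λ v → [] ⊢ code u ⟨ xs ⟩⇓ ifZero v 1 0) eq (halts u [] xs))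

recursive-∁ : {R : Pred (Vec ℕ k) 0ℓ} → Recursive R → Recursive (λ xs → ¬ R xs)
recursive-∁ {k} {R} (e , dec) = comp (code flip) [ e ] , λ xs → decided xs (dec xs)
  where
  flip : Total 0 1
  flip = subtraction ∙ (const 1 ∷ var 0F ∷ [])

  decided : ∀ xs → (R xs × [] ⊢ e ⟨ xs ⟩⇓ 1) ⊎ (¬ R xs × [] ⊢ e ⟨ xs ⟩⇓ 0) →
            (¬ R xs × [] ⊢ comp (code flip) [ e ] ⟨ xs ⟩⇓ 1) ⊎ (¬ ¬ R xs × [] ⊢ comp (code flip) [ e ] ⟨ xs ⟩⇓ 0)
  decided xs (inj₁ (r , d))  = inj₂ ((λ ¬r → ¬r r) , comp (d ∷ []) (halts flip [] _))
  decided xs (inj₂ (¬r , d)) = inj₁ (¬r , comp (d ∷ []) (halts flip [] _))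

-- A decision at every vector makes the code total; subtracting its output from 1 turns 1 for true
-- into 0 for passed.
test : {R : Pred (Vec ℕ k) 0ℓ} → Recursive R → ∃ λ (t : Total 0 k) → ∀ xs → R xs ⇔ (⟦ t ⟧ [] xs ≡ 0)
test {k} {R} (e , dec) = subtraction ∙ (const 1 ∷ χ ∷ []) , λ xs → spec (dec xs)
  where
  value : ∀ {xs} → (R xs × [] ⊢ e ⟨ xs ⟩⇓ 1) ⊎ (¬ R xs × [] ⊢ e ⟨ xs ⟩⇓ 0) → ℕ
  value (inj₁ _) = 1
  value (inj₂ _) = 0

  value-halts : ∀ {xs} (d : (R xs × [] ⊢ e ⟨ xs ⟩⇓ 1) ⊎ (¬ R xs × [] ⊢ e ⟨ xs ⟩⇓ 0)) →
                [] ⊢ e ⟨ xs ⟩⇓ value d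
  value-halts (inj₁ (_ , d)) = d
  value-halts (inj₂ (_ , d)) = d

  χ : Total 0 k
  χ = record { ⟦_⟧ = λ _ xs → value (dec xs) ; code = e ; halts = λ { [] xs → value-halts (dec xs) } }

  spec : ∀ {xs} (d : (R xs × [] ⊢ e ⟨ xs ⟩⇓ 1) ⊎ (¬ R xs × [] ⊢ e ⟨ xs ⟩⇓ 0)) → R xs ⇔ (1 ∸ value d ≡ 0)
  spec (inj₁ (r , _))  = mk⇔ (λ _ → refl) (λ _ → r)
  spec (inj₂ (¬r , _)) = mk⇔ (λ r → contradiction r ¬r) λ ()

Π₂⇒Π⁰ : ∀ {R} → Π₂ R → Π⁰ {k = 1} 2 (R ∘ head)
Π₂⇒Π⁰ (t , R⇔) = forAll
  (exists {B = λ zyn → ⟦ t ⟧ [] zyn ≡ 0} (recursive (recursive-≡0 t)) (id , id))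
  ((λ { {n ∷ []} → Equivalence.to (R⇔ n) }) , (λ { {n ∷ []} → Equivalence.from (R⇔ n) }))

Π⁰⇒Π₂ : ∀ {R} → Π⁰ {k = 1} 2 (R ∘ head) → Π₂ R
Π⁰⇒Π₂ (forAll (exists (recursive C) (B⇒ , ⇒B)) (R⇒ , ⇒R)) with t , C⇔ ← test C =
  t , λ n → mk⇔
    (λ r y → let z , c = B⇒ (R⇒ {n ∷ []} r y) in z , Equivalence.to (C⇔ _) c)
    (λ t≡0 → ⇒R {n ∷ []} λ y → ⇒B (let z , eq = t≡0 y in z , Equivalence.from (C⇔ _) eq))

Σ⁰-resp : {P R : Pred (Vec ℕ k) 0ℓ} → (∀ xs → P xs ⇔ R xs) → Σ⁰ 2 P → Σ⁰ 2 R
Σ⁰-resp P⇔R (exists b (P⇒ , ⇒P)) = exists b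
  ( (λ r → P⇒ (Equivalence.from (P⇔R _) r)) , (λ y → Equivalence.to (P⇔R _) (⇒P y)))

module _ (em : ExcludedMiddle 0ℓ) where

  ¬¬-elim : {P : Set} → ¬ ¬ P → P
  ¬¬-elim {P} ¬¬p with em {P}
  ... | yes p = p
  ... | no ¬p = contradiction ¬p ¬¬p

  -- Excluded middle moves the negation through both quantifiers, and the recursive matrix is
  -- complemented by exchanging its outputs 0 and 1.
  Σ⁰⇒∁Π⁰ : {R : Pred (Vec ℕ k) 0ℓ} → Σ⁰ 2 R → Π⁰ 2 (λ xs → ¬ R xs)
  Σ⁰⇒∁Π⁰ (exists (forAll (recursive C) (B⇒ , ⇒B)) (R⇒ , ⇒R)) = forAll
    (exists (recursive (recursive-∁ C)) (id , id))
    ( (λ ¬r y → ¬¬-elim λ ¬z → ¬r (⇒R (y , ⇒B λ z → ¬¬-elim λ ¬c → ¬z (z , ¬c))))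
    , (λ b r → let y , all = R⇒ r
                   z , ¬c = b y
               in ¬c (B⇒ all z)))

  Π⁰⇒∁Σ⁰ : {R : Pred (Vec ℕ k) 0ℓ} → Π⁰ 2 R → Σ⁰ 2 (λ xs → ¬ R xs)
  Π⁰⇒∁Σ⁰ (forAll (exists (recursive C) (B⇒ , ⇒B)) (R⇒ , ⇒R)) = exists
    (forAll (recursive (recursive-∁ C)) (id , id))
    ( (λ ¬r → ¬¬-elim λ ¬y → ¬r (⇒R λ y → ⇒B (¬¬-elim λ ¬z → ¬y (y , λ z c → ¬z (z , c)))))
    , (λ { (y , none) r → let z , c = B⇒ (R⇒ r y) in none z c }))

  -- The Σ⁰ half is traded for a Π₂ condition on the complement; coming back gives the double
  -- complement, which is removed classically.
  Δ⁰-Π₂ : ∀ {A} → Δ⁰ {k = 1} 2 (A ∘ head) ⇔ (Π₂ A × Π₂ (λ n → ¬ A n))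
  Δ⁰-Π₂ = mk⇔
    (λ { (σ , π) → Π⁰⇒Π₂ π , Π⁰⇒Π₂ (Σ⁰⇒∁Π⁰ σ) })
    (λ { (π , π′) → Σ⁰-resp (λ _ → mk⇔ ¬¬-elim (λ a ¬a → ¬a a)) (Π⁰⇒∁Σ⁰ (Π₂⇒Π⁰ π′)) , Π₂⇒Π⁰ π })

-- Points whose names survive the round trip through the ideals

-- T x s n is the value of p at x, in the encoding of eval, as known with fuel s.

Approximates : Total 0 3 → ℕ → Baire → Set
Approximates T n p =
  (∀ x s {v} → ⟦ T ⟧ [] (x ∷ s ∷ n ∷ []) ≡ suc v → p x ≡ v) ×
  (∀ x → Eventually λ s → ⟦ T ⟧ [] (x ∷ s ∷ n ∷ []) ≡ suc (p x))

module _ (G : Total 0 3) (e : Code 1 1) {n : ℕ} {p : Baire} (G≈p : Approximates G n p) where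

  -- Kept apart from `evaluator-approximates` because it serves to establish that `e` is total on
  -- `p`, which the latter takes as given.
  evaluator-sound : ∀ x s {v} → ⟦ evaluator (λ _ → G) e ⟧ [] (x ∷ s ∷ n ∷ []) ≡ suc v → [ p ] ⊢ e ⟨ [ x ] ⟩⇓ v
  evaluator-sound x s = eval-sound s (λ { 0F x → proj₁ G≈p x s }) e [ x ]

  -- Approximations compose, so the results of applying several computable maps in turn stay
  -- recursive in position, fuel and n.
  evaluator-approximates : ∀ {q} → e ⟪ p ⟫≃ q → Approximates (evaluator (λ _ → G) e) n q
  evaluator-approximates e≃q =
    (λ x s eq → deterministic (e≃q x) (evaluator-sound x s eq)) ,
    (λ x → eval-complete (λ { 0F x → proj₂ G≈p x }) (e≃q x))

1∸≡0 : ∀ x → 1 ∸ x ≡ 0 → x ≡ suc (pred x)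
1∸≡0 (suc x) _ = refl

digit : Sierpiński → ℕ
digit ⊥ = 0
digit ⊤ = 1

constant-name : Sierpiński → ℕ → Baire
constant-name b n x = ifZero x n (digit b)

names-constant : ∀ b n → RepresentedSpace.names (ℕ-space ×ᴿ 𝕊) (constant-name b n) (n , b)
names-constant ⊥ n = refl , λ k → cong (λ x → ifZero x n 0) (+-comm (2 * k) 1)
names-constant ⊤ n = refl , λ z → 1+n≢0 (z 0)

constantly : Sierpiński → Total 0 3
constantly b = successor ∙ [ conditional ∙ (var 0F ∷ var 2F ∷ const (digit b) ∷ []) ]

constantly-approximates : ∀ b n → Approximates (constantly b) n (constant-name b n)
constantly-approximates b n = (λ x s → suc-injective) , λ x → always λ s → refl

module _ (T : Total 0 3) where

  -- The arguments are (k , s , n) for ⊤ and (s , k , n) for ⊥, where s is fuel.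

  nameTotal : Sierpiński → Total 0 3
  nameTotal ⊤ = addition ∙
    ( distance ∙ (T ∙ (const 0 ∷ var 1F ∷ var 2F ∷ []) ∷ successor ∙ [ var 2F ] ∷ [])
    -- A known digit v is stored as v + 1, so the difference from 2 vanishes exactly for a known
    -- non-zero digit. In the case of ⊥, distance 0 from 1 means a known zero.
    ∷ subtraction ∙
        ( const 2
        ∷ T ∙ (addition ∙ (multiplication ∙ (const 2 ∷ var 0F ∷ []) ∷ const 1 ∷ []) ∷ var 1F ∷ var 2F ∷ [])
        ∷ [])
    ∷ [])
  nameTotal ⊥ = addition ∙
    ( distance ∙ (T ∙ (const 0 ∷ var 0F ∷ var 2F ∷ []) ∷ successor ∙ [ var 2F ] ∷ [])
    ∷ distance ∙
        ( T ∙ (addition ∙ (multiplication ∙ (const 2 ∷ var 1F ∷ []) ∷ const 1 ∷ []) ∷ var 0F ∷ var 2F ∷ [])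
        ∷ const 1
        ∷ [])
    ∷ [])

  -- For ⊤ a single non-zero digit suffices, which is an existential condition; for ⊥ every digit k
  -- is examined, and the first component along with it.
  nameTest : Sierpiński → Pred ℕ 0ℓ
  nameTest ⊤ = AllExist 2 0 (nameTotal ⊤)
  nameTest ⊥ = AllExist 1 1 (nameTotal ⊥)

  nameTest-Π₂ : ∀ b → Π₂ (nameTest b)
  nameTest-Π₂ ⊤ = allExist-Π₂ 2 0 (nameTotal ⊤)
  nameTest-Π₂ ⊥ = allExist-Π₂ 1 1 (nameTotal ⊥)

  nameTest-correct : ExcludedMiddle 0ℓ → ∀ {n r} b → Approximates T n r →
                     nameTest b n ⇔ RepresentedSpace.names (ℕ-space ×ᴿ 𝕊) r (n , b)
  nameTest-correct em {n} {r} ⊤ (sound , complete) = mk⇔ passed passes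
    where
    passed : nameTest ⊤ n → r 0 ≡ n × ¬ IsZero (odds r)
    passed test with k ∷ s ∷ [] , eq ← test [] =
      sound 0 s (∣m-n∣≡0⇒m≡n (proj₁ (+≡0 _ eq))) ,
      λ isZero → nonzero (proj₂ (+≡0 ∣ ⟦ T ⟧ [] (0 ∷ s ∷ n ∷ []) - suc n ∣ eq)) (λ {v} → sound (2 * k + 1) s {v}) (isZero k)
      where
      nonzero : ∀ {x w} → 2 ∸ x ≡ 0 → (∀ {v} → x ≡ suc v → w ≡ v) → w ≢ 0
      nonzero {suc (suc x)} _ w≡ refl with () ← w≡ refl

    passes : r 0 ≡ n × ¬ IsZero (odds r) → nameTest ⊤ n
    passes (r0≡n , ¬zero) [] =
      -- A position of a non-zero digit is obtained classically from `¬ IsZero`.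
      let k , r≢0 = ¬¬-elim em λ none → ¬zero λ k → ¬¬-elim em λ r≢0 → none (k , r≢0)
          N , both = zip _,_ (complete 0) (complete (2 * k + 1))
          eq₀ , eq₁ = both N ≤-refl
      in k ∷ N ∷ [] , cong₂ _+_
           (m≡n⇒∣m-n∣≡0 (trans eq₀ (cong suc r0≡n)))
           (trans (cong (2 ∸_) eq₁) (nonzero (odds r k) r≢0))
      where
      nonzero : ∀ w → w ≢ 0 → 1 ∸ w ≡ 0
      nonzero zero    w≢0 = contradiction refl w≢0
      nonzero (suc w) _   = 0∸n≡0 w
  nameTest-correct _ {n} {r} ⊥ (sound , complete) = mk⇔
    (λ test → sound 0 _ (∣m-n∣≡0⇒m≡n (proj₁ (passed test 0))) ,
              λ k → sound (2 * k + 1) _ (∣m-n∣≡0⇒m≡n (proj₂ (passed test k))))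
    passes
    where
    passed : (test : nameTest ⊥ n) → ∀ k → let s = head (proj₁ (test [ k ])) in
             ∣ ⟦ T ⟧ [] (0 ∷ s ∷ n ∷ []) - suc n ∣ ≡ 0 × ∣ ⟦ T ⟧ [] (2 * k + 1 ∷ s ∷ n ∷ []) - 1 ∣ ≡ 0
    passed test k with s ∷ [] , eq ← test [ k ] = +≡0 _ eq

    passes : r 0 ≡ n × IsZero (odds r) → nameTest ⊥ n
    passes (r0≡n , isZero) (k ∷ []) =
      let N , both = zip _,_ (complete 0) (complete (2 * k + 1))
          eq₀ , eq₁ = both N ≤-refl
      in N ∷ [] , cong₂ _+_
           (m≡n⇒∣m-n∣≡0 (trans eq₀ (cong suc r0≡n)))
           (m≡n⇒∣m-n∣≡0 (trans eq₁ (cong suc (isZero k))))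

≡suc⇒1∸≡0 : ∀ {x v} → x ≡ suc v → 1 ∸ x ≡ 0
≡suc⇒1∸≡0 {v = v} refl = 0∸n≡0 v

guard≡0 : ∀ {x v y} → x ≡ suc v → guard x y ≡ 0 → y ≡ 0
guard≡0 refl eq = eq

-- If either guard is 0 the test passes with any witnesses, so real ones have to be found only when
-- both values are defined.
guards≡0 : ∀ x y (d : ℕ → ℕ → ℕ) →
           (x ≡ suc (pred x) → y ≡ suc (pred y) → ∃ λ k → ∃ λ s → d k s ≡ 0) →
           ∃ λ k → ∃ λ s → guard x (guard y (d k s)) ≡ 0
guards≡0 zero    y       d f = 0 , 0 , refl
guards≡0 (suc x) zero    d f = 0 , 0 , refl
guards≡0 (suc x) (suc y) d f = f refl refl

module _ {_≪_ : Rel ℕ 0ℓ} (ce : ComputablyEnumerable _≪_) (T : Total 0 3) where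

  private
    L : Total 0 3
    L = evaluator {m = 0} (λ ()) (proj₁ ce)

    L-sound : ∀ {x y s v} → ⟦ L ⟧ [] (x ∷ y ∷ s ∷ []) ≡ suc v → x ≪ y
    L-sound {x} {y} {s} eq = Equivalence.from (proj₂ ce x y) (_ , eval-sound s (λ ()) (proj₁ ce) _ eq)

    L-complete : ∀ {x y} → x ≪ y → ∃ λ v → Eventually λ s → ⟦ L ⟧ [] (x ∷ y ∷ s ∷ []) ≡ suc v
    L-complete {x} {y} x≪y = let v , d = Equivalence.to (proj₂ ce x y) x≪y in v , eval-complete (λ ()) d

  -- The arguments are (k , s , i , j , n) and (k , s′ , x , i , s , n), where
  -- s and s′ are fuel.

  directedTotal : Total 0 5
  directedTotal = sum (holds (at 2F) ∷ holds (at 3F) ∷ holds (at 0F) ∷ holds (below 2F) ∷ holds (below 3F) ∷ [])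
    where
    sum : Vec (Total 0 5) m → Total 0 5
    sum []       = const 0
    sum (t ∷ ts) = addition ∙ (t ∷ sum ts ∷ [])

    holds : Total 0 5 → Total 0 5
    holds t = subtraction ∙ (const 1 ∷ t ∷ [])

    at below : Fin 5 → Total 0 5
    at i    = T ∙ (var i ∷ var 1F ∷ var 4F ∷ [])
    below i = L ∙ (predecessor ∙ [ at i ] ∷ predecessor ∙ [ at 0F ] ∷ var 1F ∷ [])

  lowerTotal : Total 0 6
  lowerTotal = guarding ∙ (at ∷ guarding ∙ (L ∙ (var 2F ∷ predecessor ∙ [ at ] ∷ var 4F ∷ []) ∷
    distance ∙ (T ∙ (var 0F ∷ var 1F ∷ var 5F ∷ []) ∷ successor ∙ [ var 2F ] ∷ []) ∷ []) ∷ [])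
    where
    at : Total 0 6
    at = T ∙ (var 3F ∷ var 4F ∷ var 5F ∷ [])

  -- In `lowerTest` the fuel s is universally quantified because x ≪ q i is a hypothesis there; the
  -- listing of x has its own existential fuel s′.
  directedTest lowerTest : Pred ℕ 0ℓ
  directedTest = AllExist 2 2 directedTotal
  lowerTest    = AllExist 2 3 lowerTotal

  -- The test demands that the i-th entry itself be computed, so passing it certifies totality
  -- before any sequence `q` is at hand.
  directedTest-total : ∀ {n} → directedTest n → ∀ i → ∃ λ s → ∃ λ v → ⟦ T ⟧ [] (i ∷ s ∷ n ∷ []) ≡ suc v
  directedTest-total test i with k ∷ s ∷ [] , eq ← test (i ∷ i ∷ []) =
    s , _ , 1∸≡0 _ (proj₁ (+≡0 _ eq))

  module _ {n : ℕ} {q : Baire} (T≈q : Approximates T n q) where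

    directedTest-correct : directedTest n ⇔ (∀ i j → ∃ λ k → q i ≪ q k × q j ≪ q k)
    directedTest-correct = mk⇔ passed passes
      where
      passed : directedTest n → ∀ i j → ∃ λ k → q i ≪ q k × q j ≪ q k
      passed test i j with k ∷ s ∷ [] , eq ← test (i ∷ j ∷ []) =
        let Tᵢ , eq₁ = +≡0 (1 ∸ t i s) eq
            Tⱼ , eq₂ = +≡0 (1 ∸ t j s) eq₁
            Tₖ , eq₃ = +≡0 (1 ∸ t k s) eq₂
            Lᵢ , eq₄ = +≡0 (1 ∸ ⟦ L ⟧ [] (pred (t i s) ∷ pred (t k s) ∷ s ∷ [])) eq₃
            Lⱼ , _   = +≡0 (1 ∸ ⟦ L ⟧ [] (pred (t j s) ∷ pred (t k s) ∷ s ∷ [])) eq₄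
        in k , below (found i s Tᵢ) (found k s Tₖ) (1∸≡0 _ Lᵢ) , below (found j s Tⱼ) (found k s Tₖ) (1∸≡0 _ Lⱼ)
        where
        t : ℕ → ℕ → ℕ
        t i s = ⟦ T ⟧ [] (i ∷ s ∷ n ∷ [])

        found : ∀ i s → 1 ∸ t i s ≡ 0 → q i ≡ pred (t i s)
        found i s eq = proj₁ T≈q i s (1∸≡0 _ eq)

        below : ∀ {x y a b s v} → x ≡ a → y ≡ b → ⟦ L ⟧ [] (a ∷ b ∷ s ∷ []) ≡ suc v → x ≪ y
        below refl refl = L-sound

      passes : (∀ i j → ∃ λ k → q i ≪ q k × q j ≪ q k) → directedTest n
      passes directed (i ∷ j ∷ []) =
        let k , i≪k , j≪k = directed i j
            u , Lᵢ = L-complete i≪k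
            v , Lⱼ = L-complete j≪k
            complete = proj₂ T≈q
            N , all = zip _,_ (complete i) (zip _,_ (complete j) (zip _,_ (complete k) (zip _,_ Lᵢ Lⱼ)))
            Tᵢ , Tⱼ , Tₖ , Lᵢ , Lⱼ = all N ≤-refl
        in k ∷ N ∷ [] ,
           cong₂ _+_ (≡suc⇒1∸≡0 Tᵢ) (cong₂ _+_ (≡suc⇒1∸≡0 Tⱼ) (cong₂ _+_ (≡suc⇒1∸≡0 Tₖ)
             (cong₂ _+_ (≡suc⇒1∸≡0 (below Tᵢ Tₖ Lᵢ)) (cong (_+ 0) (≡suc⇒1∸≡0 (below Tⱼ Tₖ Lⱼ))))))
        where
        below : ∀ {a b x y s v} → a ≡ suc x → b ≡ suc y → ⟦ L ⟧ [] (x ∷ y ∷ s ∷ []) ≡ suc v →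
                ⟦ L ⟧ [] (pred a ∷ pred b ∷ s ∷ []) ≡ suc v
        below refl refl eq = eq

    lowerTest-correct : lowerTest n ⇔ (∀ x i → x ≪ q i → ∃ λ k → q k ≡ x)
    lowerTest-correct = mk⇔ passed passes
      where
      passed : lowerTest n → ∀ x i → x ≪ q i → ∃ λ k → q k ≡ x
      passed test x i x≪qi =
        let v , Lᵢ = L-complete x≪qi
            N , both = zip _,_ (proj₂ T≈q i) Lᵢ
            Tᵢ , Lᵢ = both N ≤-refl
        in hit N Tᵢ Lᵢ (test (x ∷ i ∷ N ∷ []))
        where
        hit : ∀ s {v} → ⟦ T ⟧ [] (i ∷ s ∷ n ∷ []) ≡ suc (q i) → ⟦ L ⟧ [] (x ∷ q i ∷ s ∷ []) ≡ suc v →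
              (∃ λ zs → ⟦ lowerTotal ⟧ [] (zs ++ x ∷ i ∷ s ∷ n ∷ []) ≡ 0) → ∃ λ k → q k ≡ x
        hit s Tᵢ Lᵢ (k ∷ s′ ∷ [] , eq) = k , proj₁ T≈q k s′ (∣m-n∣≡0⇒m≡n
          (guard≡0 (trans (cong (λ a → ⟦ L ⟧ [] (x ∷ pred a ∷ s ∷ [])) Tᵢ) Lᵢ) (guard≡0 Tᵢ eq)))

      passes : (∀ x i → x ≪ q i → ∃ λ k → q k ≡ x) → lowerTest n
      passes lower (x ∷ i ∷ s ∷ []) =
        let k , s′ , eq = guards≡0 (⟦ T ⟧ [] (i ∷ s ∷ n ∷ []))
              (⟦ L ⟧ [] (x ∷ pred (⟦ T ⟧ [] (i ∷ s ∷ n ∷ [])) ∷ s ∷ []))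
              (λ k s′ → ∣ ⟦ T ⟧ [] (k ∷ s′ ∷ n ∷ []) - suc x ∣)
              λ Tᵢ Lᵢ →
                let k , qk≡x = lower x i (subst (x ≪_) (sym (proj₁ T≈q i s Tᵢ)) (L-sound Lᵢ))
                    N , Tₖ = proj₂ T≈q k
                in k , N , m≡n⇒∣m-n∣≡0 (trans (Tₖ N ≤-refl) (cong suc qk≡x))
        in k ∷ s′ ∷ [] , eq

-- Π₂ conditions from an isomorphism with an ideal space

module _ (em : ExcludedMiddle 0ℓ) {A : Pred ℕ 0ℓ} {_≪_ : Rel ℕ 0ℓ}
         (ce : ComputablyEnumerable _≪_) (iso : S A ≅ 𝐈 em _≪_) where

  open RepresentedSpace using (names; functional; respects)
  open _≅_ iso
  open Inverse inverse using (to; from; strictlyInverseʳ)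

  S-points-Π₂ : ∀ b → Π₂ λ n → S-points A (n , b)
  S-points-Π₂ b = Π₂-resp (λ n → mk⇔ (point n) (tests n))
    (Π₂-× (allExist-Π₂ 2 2 (directedTotal ce T))
      (Π₂-× (allExist-Π₂ 2 3 (lowerTotal ce T)) (nameTest-Π₂ U b)))
    where
    -- `T` approximates the image of the constant name, and `U` the image of that sequence under the
    -- inverse.
    T U : Total 0 3
    T = evaluator (λ _ → constantly b) (proj₁ to-computable)
    U = evaluator (λ _ → T) (proj₁ from-computable)

    Tests : Pred ℕ 0ℓ
    Tests n = directedTest ce T n × lowerTest ce T n × nameTest U b n

    T-approximates : ∀ {n q} → proj₁ to-computable ⟪ constant-name b n ⟫≃ q → Approximates T n q
    T-approximates = evaluator-approximates (constantly b) _ (constantly-approximates b _)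

    U-approximates : ∀ {n q r} → Approximates T n q → proj₁ from-computable ⟪ q ⟫≃ r → Approximates U n r
    U-approximates T≈q e≃r = evaluator-approximates T _ T≈q e≃r

    tests : ∀ n → S-points A (n , b) → Tests n
    tests n s =
      let x = (n , b) , s
          q , e≃q , I⊆q , q⊆I = proj₂ to-computable _ x (names-constant b n)
          r , e≃r , r-names   = proj₂ from-computable q (to x) (I⊆q , q⊆I)
          T≈q = T-approximates e≃q
      in Equivalence.from (directedTest-correct ce T T≈q) (λ i j →
           let z , z∈I , qi≪z , qj≪z = Ideal.directed (to x) (q⊆I (i , refl)) (q⊆I (j , refl))
               k , qk≡z = I⊆q z∈I
           in k , subst (_ ≪_) (sym qk≡z) qi≪z , subst (_ ≪_) (sym qk≡z) qj≪z) ,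
         Equivalence.from (lowerTest-correct ce T T≈q) (λ y i y≪qi →
           I⊆q (Ideal.lower (to x) y≪qi (q⊆I (i , refl)))) ,
         Equivalence.from (nameTest-correct U em b (U-approximates T≈q e≃r))
           (respects (S A) {r} {x = from (to x)} {x} (λ _ → refl) (strictlyInverseʳ x) r-names)

    point : ∀ n → Tests n → S-points A (n , b)
    point n (directed , lower , named) =
      let r , e≃r , r-names = proj₂ from-computable q I (id , id)
          r-names′ = Equivalence.to (nameTest-correct U em b (U-approximates T≈q e≃r)) named
          -- `r` names `from I`, a point of S_A, and by the test also (n , b); hence the two agree
          -- and membership carries over.
          n≡ , b≡ = functional (ℕ-space ×ᴿ 𝕊) {r} {x = proj₁ (from I)} r-names r-names′
      in subst (S-points A) (cong₂ _,_ n≡ b≡) (proj₂ (from I))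
      where
      -- Since (n , b) is not yet known to lie in S_A, the image sequence is read off the tests
      -- instead of being supplied by the isomorphism.
      q : Baire
      q i = proj₁ (proj₂ (directedTest-total ce T directed i))

      e≃q : proj₁ to-computable ⟪ constant-name b n ⟫≃ q
      e≃q i = evaluator-sound (constantly b) _ (constantly-approximates b n) i _
                (proj₂ (proj₂ (directedTest-total ce T directed i)))

      T≈q : Approximates T n q
      T≈q = T-approximates e≃q

      I : Ideal _≪_
      I = record
        { member   = Range q
        ; nonEmpty = q 0 , 0 , refl
        ; lower    = λ { x≪y (i , refl) → Equivalence.to (lowerTest-correct ce T T≈q) lower _ i x≪y }
        ; directed = λ { (i , refl) (j , refl) →
            let k , i≪k , j≪k = Equivalence.to (directedTest-correct ce T T≈q) directed i j
            in q k , (k , refl) , i≪k , j≪k }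
        }

-- The ideals of a Δ⁰₂ set

least : ∀ (f : ℕ → ℕ) z → f z ≡ 0 → ∃ λ y → f y ≡ 0 × (∀ i → i < y → f i ≢ 0)
least f zero    eq = 0 , eq , λ _ ()
least f (suc z) eq with f 0 ≟ 0
... | yes f0≡0 = 0 , f0≡0 , λ _ ()
... | no  f0≢0 with y , fy≡0 , f≢0 ← least (f ∘ suc) z eq =
  suc y , fy≡0 , λ { zero _ → f0≢0 ; (suc i) (s≤s i<y) → f≢0 i i<y }

-- The search for a zero of a total function stops at the least one, so the existence of any zero is
-- enough.
μ-halts : ∀ (t : Total j (1 + k)) φ xs →
          (∃ λ v → φ ⊢ μ (code t) ⟨ xs ⟩⇓ v) ⇔ (∃ λ z → ⟦ t ⟧ φ (z ∷ xs) ≡ 0)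
μ-halts t φ xs = mk⇔
  (λ { (v , μ d _) → v , deterministic (halts t φ _) d })
  (λ { (z , eq) →
    let y , ty≡0 , t≢0 = least (λ z → ⟦ t ⟧ φ (z ∷ xs)) z eq
    in y , μ (subst (φ ⊢ code t ⟨ y ∷ xs ⟩⇓_) ty≡0 (halts t φ _)) λ i i<y → positive i (t≢0 i i<y) })
  where
  positive : ∀ i → ⟦ t ⟧ φ (i ∷ xs) ≢ 0 → ∃ λ v → φ ⊢ code t ⟨ i ∷ xs ⟩⇓ suc v
  positive i t≢0 with ⟦ t ⟧ φ (i ∷ xs) | halts t φ (i ∷ xs)
  ... | zero  | _ = contradiction refl t≢0
  ... | suc v | d = v , d

-- Composition evaluates all its arguments even though `zer` ignores them, so it expresses
-- conjunction of semi-decidable conditions.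
both-halt : ∀ {c d : Code j k} {φ xs} →
            (∃ λ v → φ ⊢ comp zer (c ∷ d ∷ []) ⟨ xs ⟩⇓ v) ⇔
            ((∃ λ v → φ ⊢ c ⟨ xs ⟩⇓ v) × (∃ λ v → φ ⊢ d ⟨ xs ⟩⇓ v))
both-halt = mk⇔ (λ { (_ , comp (d ∷ d′ ∷ []) _) → (_ , d) , (_ , d′) })
                (λ { ((_ , d) , (_ , d′)) → 0 , comp (d ∷ d′ ∷ []) zer })

comp-halts : ∀ (c : Code j m) (us : Vec (Total j k) m) {φ xs v} →
             φ ⊢ comp c (map code us) ⟨ xs ⟩⇓ v ⇔ φ ⊢ c ⟨ map (λ u → ⟦ u ⟧ φ xs) us ⟩⇓ v
comp-halts c us {φ} {xs} {v} = mk⇔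
  (λ { (comp ds d) → subst (λ ys → φ ⊢ c ⟨ ys ⟩⇓ v) (values us ds) d })
  (comp (codes-halt us φ xs))
  where
  values : ∀ (us : Vec (Total _ _) n) {ys} → φ ⊢ map code us ⟨ xs ⟩⇓* ys → ys ≡ map (λ u → ⟦ u ⟧ φ xs) us
  values []       []       = refl
  values (u ∷ us) (d ∷ ds) = cong₂ _∷_ (deterministic d (halts u φ xs)) (values us ds)

-- Each round of the recursion runs one unbounded search and drops the previous value; only the
-- halting of all rounds matters.
boundedSearch : Total j 3 → Code j 2
boundedSearch t = prec zer (μ (code (t ∙ (var 0F ∷ var 1F ∷ var 3F ∷ []))))

boundedSearch-halts : ∀ (t : Total j 3) φ m x →
  (∃ λ v → φ ⊢ boundedSearch t ⟨ m ∷ x ∷ [] ⟩⇓ v) ⇔ (∀ i → i < m → ∃ λ z → ⟦ t ⟧ φ (z ∷ i ∷ x ∷ []) ≡ 0)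
boundedSearch-halts t φ m x = mk⇔ (λ { (v , d) → found m d }) (halt m)
  where
  t′ = t ∙ (var 0F ∷ var 1F ∷ var 3F ∷ [])

  found : ∀ m {v} → φ ⊢ boundedSearch t ⟨ m ∷ x ∷ [] ⟩⇓ v →
          ∀ i → i < m → ∃ λ z → ⟦ t ⟧ φ (z ∷ i ∷ x ∷ []) ≡ 0
  found (suc m) (prec-s d d′) i i<1+m with m<1+n⇒m<n∨m≡n i<1+m
  ... | inj₁ i<m  = found m d i i<m
  ... | inj₂ refl = Equivalence.to (μ-halts t′ φ (m ∷ _ ∷ x ∷ [])) (_ , d′)

  halt : ∀ m → (∀ i → i < m → ∃ λ z → ⟦ t ⟧ φ (z ∷ i ∷ x ∷ []) ≡ 0) →
         ∃ λ v → φ ⊢ boundedSearch t ⟨ m ∷ x ∷ [] ⟩⇓ v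
  halt zero    _ = 0 , prec-z zer
  halt (suc m) f =
    let v , d  = halt m λ i i<m → f i (m<n⇒m<1+n i<m)
        w , d′ = Equivalence.from (μ-halts t′ φ (m ∷ v ∷ x ∷ [])) (f m (n<1+n m))
    in w , prec-s d d′

-- Triples and their order

flag stage : ℕ → ℕ
flag x  = fst (snd x)
stage x = snd (snd x)

element : ℕ → ℕ → ℕ → ℕ
element n b k = pair n (pair b k)

fst-element : ∀ n b k → fst (element n b k) ≡ n
fst-element n b k = fst-pair n (pair b k)

flag-element : ∀ n b k → flag (element n b k) ≡ b
flag-element n b k = trans (cong fst (snd-pair n (pair b k))) (fst-pair b k)

stage-element : ∀ n b k → stage (element n b k) ≡ k
stage-element n b k = trans (cong snd (snd-pair n (pair b k))) (snd-pair b k)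

infix 4 _⊑_ _⊏_

-- Every number decodes to a triple, with an arbitrary flag; all non-zero flags count as 1.
_⊑_ _⊏_ : Rel ℕ 0ℓ
x ⊑ y = fst x ≡ fst y × (flag x ≡ 0 ⊎ flag y ≢ 0)
x ⊏ y = x ⊑ y × stage x < stage y

⊑-trans : ∀ {x y z} → x ⊑ y → y ⊑ z → x ⊑ z
⊑-trans (x≡y , inj₁ x₀) (y≡z , _)        = trans x≡y y≡z , inj₁ x₀
⊑-trans (x≡y , inj₂ y₁) (y≡z , inj₁ y₀)  = contradiction y₀ y₁
⊑-trans (x≡y , inj₂ y₁) (y≡z , inj₂ z₁)  = trans x≡y y≡z , inj₂ z₁

flagging : Total j 1
flagging = first ∙ [ second ]

staging : Total j 1
staging = second ∙ [ second ]

-- A product of tests expresses a disjunction.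
x*[1∸y]≡0⇔ : ∀ x y → (x * (1 ∸ y) ≡ 0) ⇔ (x ≡ 0 ⊎ y ≢ 0)
x*[1∸y]≡0⇔ x zero    = mk⇔ (λ eq → inj₁ (trans (sym (*-identityʳ x)) eq))
  λ { (inj₁ refl) → refl ; (inj₂ y≢0) → contradiction refl y≢0 }
x*[1∸y]≡0⇔ x (suc y) = mk⇔ (λ _ → inj₂ 1+n≢0) (λ _ → trans (cong (x *_) (0∸n≡0 y)) (*-zeroʳ x))

⊑-test : Total j 2
⊑-test = addition ∙
  ( distance ∙ (first ∙ [ var 0F ] ∷ first ∙ [ var 1F ] ∷ [])
  ∷ multiplication ∙ (flagging ∙ [ var 0F ] ∷ subtraction ∙ (const 1 ∷ flagging ∙ [ var 1F ] ∷ []) ∷ [])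
  ∷ [])

⊏-test : Total j 2
⊏-test = addition ∙
  ( ⊑-test
  ∷ subtraction ∙ (successor ∙ [ staging ∙ [ var 0F ] ] ∷ staging ∙ [ var 1F ] ∷ [])
  ∷ [])

⊑-test-correct : ∀ (φ : Vec Baire j) x y → ⟦ ⊑-test ⟧ φ (x ∷ y ∷ []) ≡ 0 ⇔ x ⊑ y
⊑-test-correct φ x y = mk⇔
  (λ eq → let fst≡ , flag≤ = +≡0 ∣ fst x - fst y ∣ eq
          in ∣m-n∣≡0⇒m≡n fst≡ , Equivalence.to (x*[1∸y]≡0⇔ (flag x) (flag y)) flag≤)
  (λ { (fst≡ , flag≤) → cong₂ _+_ (m≡n⇒∣m-n∣≡0 fst≡) (Equivalence.from (x*[1∸y]≡0⇔ (flag x) (flag y)) flag≤) })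

⊏-test-correct : ∀ (φ : Vec Baire j) x y → ⟦ ⊏-test ⟧ φ (x ∷ y ∷ []) ≡ 0 ⇔ x ⊏ y
⊏-test-correct φ x y = mk⇔
  (λ eq → let ⊑≡ , <≡ = +≡0 (⟦ ⊑-test ⟧ φ (x ∷ y ∷ [])) eq
          in Equivalence.to (⊑-test-correct φ x y) ⊑≡ , m∸n≡0⇒m≤n <≡)
  (λ { (x⊑y , x<y) → cong₂ _+_ (Equivalence.from (⊑-test-correct φ x y) x⊑y) (m≤n⇒m∸n≡0 x<y) })

-- The relation obtained from two Π₂ conditions

module _ (em : ExcludedMiddle 0ℓ) {A : Pred ℕ 0ℓ} (A-Π₂ : Π₂ A) (∁A-Π₂ : Π₂ λ n → ¬ A n) where

  private
    V : Total 0 3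
    V = conditional ∙
      ( flagging ∙ [ var 2F ]
      ∷ proj₁ ∁A-Π₂ ∙ (var 0F ∷ var 1F ∷ first ∙ [ var 2F ] ∷ [])
      ∷ proj₁ A-Π₂ ∙ (var 0F ∷ var 1F ∷ first ∙ [ var 2F ] ∷ [])
      ∷ [])

  Verified : ℕ → ℕ → Set
  Verified i x = ∃ λ z → ⟦ V ⟧ [] (z ∷ i ∷ x ∷ []) ≡ 0

  all-verified : ∀ {x} → (flag x ≡ 0 → ¬ A (fst x)) → (flag x ≢ 0 → A (fst x)) → ∀ i → Verified i x
  all-verified {x} out in′ i with flag x
  ... | zero  = Equivalence.to (proj₂ ∁A-Π₂ _) (out refl) i
  ... | suc _ = Equivalence.to (proj₂ A-Π₂ _) (in′ 1+n≢0) i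

  -- The element may vary with i, since an instance depends only on the number and on whether the
  -- flag is 0.
  verified-∉ : ∀ n → (∀ i → ∃ λ x → fst x ≡ n × flag x ≡ 0 × Verified i x) → ¬ A n
  verified-∉ n f = Equivalence.from (proj₂ ∁A-Π₂ n) λ i → extract i (f i)
    where
    extract : ∀ i → (∃ λ x → fst x ≡ n × flag x ≡ 0 × Verified i x) →
              ∃ λ z → ⟦ proj₁ ∁A-Π₂ ⟧ [] (z ∷ i ∷ n ∷ []) ≡ 0
    extract i (x , refl , x₀ , z , eq) with flag x
    ... | zero = z , eq

  verified-∈ : ∀ n → (∀ i → ∃ λ x → fst x ≡ n × flag x ≢ 0 × Verified i x) → A n
  verified-∈ n f = Equivalence.from (proj₂ A-Π₂ n) λ i → extract i (f i)
    where
    extract : ∀ i → (∃ λ x → fst x ≡ n × flag x ≢ 0 × Verified i x) →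
              ∃ λ z → ⟦ proj₁ A-Π₂ ⟧ [] (z ∷ i ∷ n ∷ []) ≡ 0
    extract i (x , refl , x₁ , z , eq) with flag x
    ... | zero  = contradiction refl x₁
    ... | suc _ = z , eq

  infix 4 _≪_

  _≪_ : Rel ℕ 0ℓ
  x ≪ y = x ⊏ y × (∀ i → i < stage y → Verified i y)

  -- Verification concerns only the upper element, so it is inherited from the second comparison.
  ≪-trans : Transitive _≪_
  ≪-trans ((x⊑y , x<y) , _) ((y⊑z , y<z) , v) = (⊑-trans x⊑y y⊑z , <-trans x<y y<z) , v

  ≪-ce : ComputablyEnumerable _≪_
  ≪-ce = comp zer (μ (code t) ∷ comp (boundedSearch V) (map code us) ∷ []) , λ x y → mk⇔
    (λ (x⊏y , v) → Equivalence.from both-halt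
      ( Equivalence.from (μ-halts t [] (x ∷ y ∷ [])) (0 , Equivalence.from (⊏-test-correct [] x y) x⊏y)
      , (let w , d = Equivalence.from (boundedSearch-halts V [] (stage y) y) v
         in w , Equivalence.from (comp-halts (boundedSearch V) us) d)))
    (λ d → let d₁ , w , d₂ = Equivalence.to both-halt d in
      Equivalence.to (⊏-test-correct [] x y) (proj₂ (Equivalence.to (μ-halts t [] (x ∷ y ∷ [])) d₁)) ,
      Equivalence.to (boundedSearch-halts V [] (stage y) y) (w , Equivalence.to (comp-halts (boundedSearch V) us) d₂))
    where
    t : Total 0 3
    -- The search variable is ignored, so the search halts exactly when the decidable part of the
    -- relation holds.
    t = ⊏-test ∙ (var 1F ∷ var 2F ∷ [])

    us : Vec (Total 0 2) 2
    us = staging ∙ [ var 1F ] ∷ var 1F ∷ []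

  -- The ideal of a point

  open RepresentedSpace using (Carrier; names)

  ideal : Carrier (S A) → Ideal _≪_
  ideal ((n , b) , s) = record
    { member   = λ x → fst x ≡ n × (flag x ≡ 0 ⊎ b ≡ ⊤)
    ; nonEmpty = element n 0 0 , fst-element n 0 0 , inj₁ (flag-element n 0 0)
    ; lower    = λ { ((x⊑y , _) , _) y∈I → lower x⊑y y∈I }
    ; directed = λ {x} {y} x∈I y∈I →
        -- The upper bound carries the flag that is true of n, so its claim can be verified up to
        -- any stage.
        let z = element n (digit b) (suc (stage x ⊔ stage y))
        in z , (fst-element n _ _ , top b (flag-element n _ _)) ,
           below b x∈I (flag-element n _ _) (m≤m⊔n (stage x) (stage y)) s ,
           below b y∈I (flag-element n _ _) (m≤n⊔m (stage x) (stage y)) s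
    }
    where
    lower : ∀ {x y} → x ⊑ y → fst y ≡ n × (flag y ≡ 0 ⊎ b ≡ ⊤) → fst x ≡ n × (flag x ≡ 0 ⊎ b ≡ ⊤)
    lower (x≡y , inj₁ x₀) (y≡n , _)       = trans x≡y y≡n , inj₁ x₀
    lower (x≡y , inj₂ y₁) (y≡n , inj₁ y₀) = contradiction y₀ y₁
    lower (x≡y , inj₂ y₁) (y≡n , inj₂ b₁) = trans x≡y y≡n , inj₂ b₁

    top : ∀ b {l} → l ≡ digit b → l ≡ 0 ⊎ b ≡ ⊤
    top ⊥ l≡ = inj₁ l≡
    top ⊤ _  = inj₂ refl

    below : ∀ b {x k} → fst x ≡ n × (flag x ≡ 0 ⊎ b ≡ ⊤) →
            flag (element n (digit b) (suc k)) ≡ digit b → stage x ≤ k →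
            S-points A (n , b) → x ≪ element n (digit b) (suc k)
    below b {x} {k} (x≡n , x≤b) z≡b x≤k s =
      ((trans x≡n (sym z≡n) , flag≤ b x≤b z≡b) ,
       subst (stage x <_) (sym (stage-element n _ _)) (s≤s x≤k)) ,
      λ i _ → all-verified (out b s z≡b) (in′ b s z≡b) i
      where
      z = element n (digit b) (suc k)

      z≡n : fst z ≡ n
      z≡n = fst-element n _ _

      flag≤ : ∀ b → flag x ≡ 0 ⊎ b ≡ ⊤ → ∀ {l} → l ≡ digit b → flag x ≡ 0 ⊎ l ≢ 0
      flag≤ b (inj₁ x₀)   _    = inj₁ x₀
      flag≤ _ (inj₂ refl) refl = inj₂ 1+n≢0

      out : ∀ b → S-points A (n , b) → ∀ {l} → l ≡ digit b → l ≡ 0 → ¬ A (fst z)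
      out ⊥ n∉A _    _ = subst (λ n → ¬ A n) (sym z≡n) n∉A
      out ⊤ _   refl ()

      in′ : ∀ b → S-points A (n , b) → ∀ {l} → l ≡ digit b → l ≢ 0 → A (fst z)
      in′ ⊥ _   refl l≢0 = contradiction refl l≢0
      in′ ⊤ n∈A _    _   = subst A (sym z≡n) n∈A

  ideal-cong : ∀ {s t} → RepresentedSpace._≈_ (S A) s t → Ideal.member (ideal s) ≐ Ideal.member (ideal t)
  ideal-cong (refl , refl) = id , id

  -- The triple (n, 0, 0) lies in the ideal and determines n; the triple (n, 1, 0) lies in it only
  -- if b is ⊤.
  ideal-injective : ∀ {s t} → Ideal.member (ideal s) ≐ Ideal.member (ideal t) → RepresentedSpace._≈_ (S A) s t
  ideal-injective {(n , b) , _} {(m , c) , _} (⊆ , ⊇) =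
    trans (sym (fst-element n 0 0)) (proj₁ (⊆ (fst-element n 0 0 , inj₁ (flag-element n 0 0)))) ,
    equal b c (λ b₁ → flagged (proj₂ (⊆ {element n 1 0} (fst-element n 1 0 , inj₂ b₁))))
              (λ c₁ → flagged (proj₂ (⊇ {element m 1 0} (fst-element m 1 0 , inj₂ c₁))))
    where
    flagged : ∀ {n b} → flag (element n 1 0) ≡ 0 ⊎ b ≡ ⊤ → b ≡ ⊤
    flagged (inj₁ eq) = contradiction (trans (sym (flag-element _ 1 0)) eq) 1+n≢0
    flagged (inj₂ eq) = eq

    equal : ∀ b c → (b ≡ ⊤ → c ≡ ⊤) → (c ≡ ⊤ → b ≡ ⊤) → b ≡ c
    equal ⊤ c f _ = sym (f refl)
    equal ⊥ ⊤ _ g = g refl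
    equal ⊥ ⊥ _ _ = refl

  -- The point of an ideal

  module _ (I : Ideal _≪_) where

    open Ideal I using (member; nonEmpty; lower; directed)

    private
      y₀ = proj₁ nonEmpty

    -- Directedness applied to an element and itself yields a member of strictly larger stage.
    climb : ∀ k {y} → y ∈ member → ∃ λ z → z ∈ member × y ≪ z × k ≤ stage z
    climb zero    y∈I = let z , z∈I , y≪z , _ = directed y∈I y∈I in z , z∈I , y≪z , z≤n
    climb (suc k) y∈I with z , z∈I , y≪z , k≤z ← climb k y∈I
      with w , w∈I , z≪w , _ ← directed z∈I z∈I =
      w , w∈I , ≪-trans y≪z z≪w , ≤-<-trans k≤z (proj₂ (proj₁ z≪w))

    -- Some member above y has a stage beyond that of x and is verified up to its own stage, so x ≪
    -- that member. Hence stages do not affect membership.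
    ⊑-closed : ∀ {x y} → x ⊑ y → y ∈ member → x ∈ member
    ⊑-closed {x} x⊑y y∈I with z , z∈I , ((y⊑z , _) , v) , x<z ← climb (suc (stage x)) y∈I =
      lower ((⊑-trans x⊑y y⊑z , x<z) , v) z∈I

    verified : ∀ i {y} → y ∈ member → ∃ λ z → z ∈ member × y ⊑ z × Verified i z
    verified i y∈I with z , z∈I , ((y⊑z , _) , v) , i<z ← climb (suc i) y∈I = z , z∈I , y⊑z , v i i<z

    fst-unique : ∀ {x y} → x ∈ member → y ∈ member → fst x ≡ fst y
    fst-unique x∈I y∈I with z , _ , (((x≡z , _) , _) , _) , (((y≡z , _) , _) , _) ← directed x∈I y∈I =
      trans x≡z (sym y≡z)

    Flagged : Set
    Flagged = ∃ λ y → y ∈ member × flag y ≢ 0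

    unflagged : ¬ Flagged → ∀ {x} → x ∈ member → flag x ≡ 0
    unflagged none {x} x∈I = ¬¬-elim em λ x₁ → none (x , x∈I , x₁)

    -- The second coordinate rests on a classical decision, taken as an argument so that later
    -- proofs can split on it.
    pointOf : Dec Flagged → Carrier (S A)
    pointOf (yes (y , y∈I , y₁)) = (fst y₀ , ⊤) , verified-∈ (fst y₀) λ i →
      let z , z∈I , y⊑z , v = verified i y∈I
      in z , fst-unique z∈I (proj₂ nonEmpty) , flagged (proj₂ y⊑z) , v
      where
      flagged : ∀ {z} → flag y ≡ 0 ⊎ flag z ≢ 0 → flag z ≢ 0
      flagged (inj₁ y₀) = contradiction y₀ y₁
      flagged (inj₂ z₁) = z₁
    pointOf (no none) = (fst y₀ , ⊥) , verified-∉ (fst y₀) λ i →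
      let z , z∈I , _ , v = verified i (proj₂ nonEmpty)
      in z , fst-unique z∈I (proj₂ nonEmpty) , unflagged none z∈I , v

    ideal-pointOf : ∀ d → Ideal.member (ideal (pointOf d)) ≐ member
    ideal-pointOf (yes (y , y∈I , y₁)) =
      (λ { (x≡y₀ , _) → ⊑-closed (trans x≡y₀ (fst-unique (proj₂ nonEmpty) y∈I) , inj₂ y₁) y∈I }) ,
      (λ x∈I → fst-unique x∈I (proj₂ nonEmpty) , inj₂ refl)
    ideal-pointOf (no none) =
      (λ { (x≡y₀ , inj₁ x₀) → ⊑-closed (x≡y₀ , inj₁ x₀) (proj₂ nonEmpty) }) ,
      (λ x∈I → fst-unique x∈I (proj₂ nonEmpty) , inj₁ (unflagged none x∈I))

    -- A name can be read off an enumeration without making the decision: any listed triple gives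
    -- the number, and the flags serve as digits. This makes `point` computable.
    names-pointOf : ∀ d {q r} → member ≐ Range q → r 0 ≡ fst (q 0) → (∀ k → odds r k ≡ flag (q k)) →
                    names (S A) r (pointOf d)
    names-pointOf (yes (y , y∈I , y₁)) {q} (⊆ , ⊇) r₀ rₖ =
      trans r₀ (fst-unique (⊇ (0 , refl)) (proj₂ nonEmpty)) ,
      λ isZero → let k , qk≡y = ⊆ y∈I in y₁ (trans (cong flag (sym qk≡y)) (trans (sym (rₖ k)) (isZero k)))
    names-pointOf (no none) (⊆ , ⊇) r₀ rₖ =
      trans r₀ (fst-unique (⊇ (0 , refl)) (proj₂ nonEmpty)) ,
      λ k → trans (rₖ k) (unflagged none (⊇ (k , refl)))

    point : Carrier (S A)
    point = pointOf em

  -- The isomorphism and its computability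

  ideal-point : ∀ I → Ideal.member (ideal (point I)) ≐ Ideal.member I
  ideal-point I = ideal-pointOf I em

  private
    module ≐ = Setoid (≐-setoid ℕ 0ℓ)

  ideal-inverse : Inverse (RepresentedSpace.points (S A)) (RepresentedSpace.points (𝐈 em _≪_))
  ideal-inverse = record
    { to        = ideal
    ; from      = point
    ; to-cong   = λ {s} {t} → ideal-cong {s} {t}
    -- `point` uses a chosen member and a decision; injectivity of `ideal` shows that the result
    -- depends only on the set of members.
    ; from-cong = λ {I} {J} I≐J → ideal-injective {point I} {point J}
        (≐.trans (ideal-point I) (≐.trans I≐J (≐.sym (ideal-point J))))
    ; inverse   =
        (λ {I} {s} s≈ → ≐.trans (ideal-cong {s} {point I} s≈) (ideal-point I)) ,
        (λ {s} {I} I≐ → ideal-injective {point I} {s} (≐.trans (ideal-point I) I≐))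
    }

  -- The number m = ⟨x , k⟩ lists x if the k-th digit of the name already shows
  -- that x belongs to the ideal, and lists a member of every ideal at n otherwise.

  ideal-computable : Computable (S A) (𝐈 em _≪_) ideal
  ideal-computable = code t , λ p s p-names → q p , (λ m → halts t [ p ] [ m ]) , listed p s p-names
    where
    check : Total 1 1
    check = addition ∙
      ( distance ∙ (first ∙ [ first ] ∷ query ∙ [ const 0 ] ∷ [])
      ∷ multiplication ∙
          ( flagging ∙ [ first ]
          ∷ subtraction ∙
              ( const 1
              ∷ query ∙ [ addition ∙ (multiplication ∙ (const 2 ∷ second ∷ []) ∷ const 1 ∷ []) ]
              ∷ [])
          ∷ [])
      ∷ [])

    t : Total 1 1
    t = conditional ∙
      (check ∷ first ∷ pairing ∙ (query ∙ [ const 0 ] ∷ pairing ∙ (const 0 ∷ const 0 ∷ []) ∷ []) ∷ [])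

    q : Baire → Baire
    q p m = ⟦ t ⟧ [ p ] [ m ]

    check-correct : ∀ p m → ⟦ check ⟧ [ p ] [ m ] ≡ 0 ⇔
                            (fst (fst m) ≡ p 0 × (flag (fst m) ≡ 0 ⊎ odds p (snd m) ≢ 0))
    check-correct p m = mk⇔
      (λ eq → let fst≡ , flag≤ = +≡0 ∣ fst (fst m) - p 0 ∣ eq
              in ∣m-n∣≡0⇒m≡n fst≡ , Equivalence.to (x*[1∸y]≡0⇔ (flag (fst m)) (odds p (snd m))) flag≤)
      (λ { (fst≡ , flag≤) → cong₂ _+_ (m≡n⇒∣m-n∣≡0 fst≡)
             (Equivalence.from (x*[1∸y]≡0⇔ (flag (fst m)) (odds p (snd m))) flag≤) })

    listed : ∀ p s → names (S A) p s → Ideal.member (ideal s) ≐ Range (q p)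
    listed p ((n , b) , s) (refl , b-names) = complete , λ { (m , refl) → sound m }
      where
      seen : ∀ b → namesSierpiński (odds p) b → ∀ {x} → flag x ≡ 0 ⊎ b ≡ ⊤ →
             ∃ λ k → flag x ≡ 0 ⊎ odds p k ≢ 0
      seen b b-names  (inj₁ x₀)   = 0 , inj₁ x₀
      seen _ ¬isZero  (inj₂ refl) = ¬¬-elim em λ none →
        ¬isZero λ k → ¬¬-elim em λ pk≢0 → none (k , inj₂ pk≢0)

      complete : ∀ {x} → fst x ≡ p 0 × (flag x ≡ 0 ⊎ b ≡ ⊤) → Range (q p) x
      complete {x} (x≡n , x≤b) =
        let k , flag≤ = seen b b-names x≤b
        in pair x k , hit k flag≤
        where
        hit : ∀ k → flag x ≡ 0 ⊎ odds p k ≢ 0 → q p (pair x k) ≡ x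
        hit k flag≤ = trans
          (cong (λ c → ifZero c (fst (pair x k)) (pair (p 0) (pair 0 0)))
            (Equivalence.from (check-correct p (pair x k))
              (subst₂ (λ y l → fst y ≡ p 0 × (flag y ≡ 0 ⊎ odds p l ≢ 0))
                (sym (fst-pair x k)) (sym (snd-pair x k)) (x≡n , flag≤))))
          (fst-pair x k)

      shown : ∀ b → namesSierpiński (odds p) b → ∀ {x k} → flag x ≡ 0 ⊎ odds p k ≢ 0 → flag x ≡ 0 ⊎ b ≡ ⊤
      shown b _      (inj₁ x₀)   = inj₁ x₀
      shown ⊤ _      (inj₂ _)    = inj₂ refl
      shown ⊥ isZero {k = k} (inj₂ pk≢0) = contradiction (isZero k) pk≢0

      sound : ∀ m → fst (q p m) ≡ p 0 × (flag (q p m) ≡ 0 ⊎ b ≡ ⊤)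
      sound m = choose (⟦ check ⟧ [ p ] [ m ]) (λ eq → let x≡n , flag≤ = Equivalence.to (check-correct p m) eq
                                                       in x≡n , shown b b-names {k = snd m} flag≤)
        where
        choose : ∀ c → (c ≡ 0 → fst (fst m) ≡ p 0 × (flag (fst m) ≡ 0 ⊎ b ≡ ⊤)) →
                 let x = ifZero c (fst m) (element (p 0) 0 0) in fst x ≡ p 0 × (flag x ≡ 0 ⊎ b ≡ ⊤)
        choose zero    f = f refl
        choose (suc _) f = fst-element (p 0) 0 0 , inj₁ (flag-element (p 0) 0 0)

  point-computable : Computable (𝐈 em _≪_) (S A) point
  point-computable = code t , λ q I q-names →
    (λ m → ⟦ t ⟧ [ q ] [ m ]) , (λ m → halts t [ q ] [ m ]) ,
    names-pointOf I em {r = λ m → ⟦ t ⟧ [ q ] [ m ]} q-names refl (at-odds q)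
    where
    t : Total 1 1
    t = conditional ∙
      -- Position 0 gives the number, and a position m > 0 the flag of entry ⌊m/2⌋, which is entry k
      -- for m = 2k + 1.
      (var 0F ∷ first ∙ [ query ∙ [ const 0 ] ] ∷ flagging ∙ [ query ∙ [ halving ] ] ∷ [])

    at-odds : ∀ q k → ⟦ t ⟧ [ q ] [ 2 * k + 1 ] ≡ flag (q k)
    at-odds q k = trans
      (cong (λ m → ⟦ t ⟧ [ q ] [ m ]) (trans (+-comm (2 * k) 1) (cong (λ l → suc (k + l)) (+-identityʳ k))))
      (cong (flag ∘ q) (sym (n≡⌈n+n/2⌉ k)))

  S-quasi-Polish : PrecomputablyQuasiPolish em (S A)
  S-quasi-Polish = _≪_ , ≪-trans , ≪-ce , record
    { inverse         = ideal-inverse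
    ; to-computable   = ideal-computable
    ; from-computable = point-computable
    }

proposition24 : (em : ExcludedMiddle 0ℓ) (A : Pred ℕ 0ℓ) →
    PrecomputablyQuasiPolish em (S A) ⇔ Δ⁰ {k = 1} 2 (A ∘ head)
proposition24 em A = mk⇔
  (λ { (_≪_ , _ , ce , iso) →
    Equivalence.from (Δ⁰-Π₂ em) (S-points-Π₂ em {A} ce iso ⊤ , S-points-Π₂ em {A} ce iso ⊥) })
  (λ δ → let A-Π₂ , ∁A-Π₂ = Equivalence.to (Δ⁰-Π₂ em) δ in S-quasi-Polish em A-Π₂ ∁A-Π₂)
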